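{- Let $n\ge 3$ and let $G$ be the transitive permutation group arising from the action of $\mathrm{PSL}(2,3^n)$ (by left multiplication) on the set of left cosets of a subgroup of order $3$. Then $$\rho(G)=\begin{cases} 3^{n-1} & \text{if } n \text{ is odd},\\ 3^{n/2-1} & \text{if } n \text{ is even}.\end{cases}$$
   Context: For a finite permutation group $G\le \mathrm{Sym}(V)$, a subset $\mathcal{F}\subseteq G$ is intersecting if for any $g,h\in\mathcal{F}$ there is $v\in V$ with $g(v)=h(v)$. The intersection density of an intersecting set $\mathcal{F}$ is $|\mathcal{F}|/\max\{|G_v| : v\in V\}$, where $G_v$ is the stabilizer of $v$, and the intersection density $\rho(G)$ of $G$ is the maximum of this quantity over all intersecting sets $\mathcal{F}$ of $G$. -}

module Defs where

open import Level using (0ℓ)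
open import Data.Nat using (ℕ; _≤_) renaming (_*_ to _*ℕ_)
open import Data.Product using (Σ; ∃; _×_; _,_)
open import Data.Sum using (_⊎_)
open import Data.Unit using (⊤)
open import Data.List using (List; length)
open import Data.List.Relation.Unary.All using (All)
open import Data.List.Relation.Unary.Any using (Any)
open import Data.List.Relation.Unary.AllPairs using (AllPairs)
open import Data.List.Membership.Propositional using (_∈_)
open import Relation.Nullary using (¬_)
open import Relation.Binary.PropositionalEquality using (_≡_)
open import Algebra.Bundles using (CommutativeRing)

IsCard : {A : Set} → (A → A → Set) → (A → Set) → ℕ → Set
IsCard {A} _~_ P k =
  Σ (List A) λ xs →
    length xs ≡ k
    × All P xs
    × AllPairs (λ x y → ¬ (x ~ y)) xs
    × (∀ a → P a → Any (λ x → a ~ x) xs)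

record FiniteField (q : ℕ) : Set₁ where
  field
    cring : CommutativeRing 0ℓ 0ℓ
  open CommutativeRing cring public
  field
    nontrivial : ¬ (1# ≈ 0#)
    inverse    : ∀ x → ¬ (x ≈ 0#) → ∃ λ y → (x * y) ≈ 1#
    card       : IsCard _≈_ (λ _ → ⊤) q

module _ {q : ℕ} (F : FiniteField q) where
  open FiniteField F

  record Mat : Set where
    constructor mat
    field a b c d : Carrier

  open Mat

  I₂ : Mat
  I₂ = mat 1# 0# 0# 1#

  _·_ : Mat → Mat → Mat
  m · n = mat (a m * a n + b m * c n) (a m * b n + b m * d n)
              (c m * a n + d m * c n) (c m * b n + d m * d n)

  -- inverse of a determinant-one matrix (adjugate)
  adj : Mat → Mat
  adj m = mat (d m) (- b m) (- c m) (a m)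

  neg : Mat → Mat
  neg m = mat (- a m) (- b m) (- c m) (- d m)

  det : Mat → Carrier
  det m = a m * d m - b m * c m

  SL : Mat → Set
  SL m = det m ≈ 1#

  _≈M_ : Mat → Mat → Set
  m ≈M n = (a m ≈ a n) × (b m ≈ b n) × (c m ≈ c n) × (d m ≈ d n)

  -- equality in PSL(2,F) = SL(2,F)/{±I}
  _~_ : Mat → Mat → Set
  m ~ n = (m ≈M n) ⊎ (m ≈M neg n)

  IsSubgroupPSL : (Mat → Set) → Set
  IsSubgroupPSL P =
    (∀ m → P m → SL m)
    × (∀ m n → m ~ n → P m → P n)
    × P I₂
    × (∀ m n → P m → P n → P (m · n))
    × (∀ m → P m → P (adj m))

  module _ (H : Mat → Set) where
    -- equality of left cosets xH = yH  (points of the action)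
    _≡H_ : Mat → Mat → Set
    x ≡H y = ∃ λ h → H h × (y ~ (x · h))

    Stab : Mat → Mat → Set
    Stab x g = SL g × ((g · x) ≡H x)

    IsMaxStab : ℕ → Set
    IsMaxStab s =
      (∃ λ x → SL x × IsCard _~_ (Stab x) s)
      × (∀ x k → SL x → IsCard _~_ (Stab x) k → k ≤ s)

    IsGroupSubset : List Mat → Set
    IsGroupSubset L = All SL L × AllPairs (λ g h → ¬ (g ~ h)) L

    Intersecting : List Mat → Set
    Intersecting L =
      ∀ g h → g ∈ L → h ∈ L → ∃ λ x → SL x × ((g · x) ≡H (h · x))

    -- ρ(G) = r  (r a natural number): with s = max_v |G_v|, the maximum
    -- size of an intersecting set equals r * s
    DensityEq : ℕ → Set
    DensityEq r =
      ∃ λ s → IsMaxStab s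
        × (∃ λ L → IsGroupSubset L × Intersecting L × length L ≡ r *ℕ s)
        × (∀ L → IsGroupSubset L → Intersecting L → length L ≤ r *ℕ s)

{-# OPTIONS --safe #-}
-- The elements of order 3 in PSL(2,q), q = 3ⁿ, are the transvections T e v = I + e v vᵀ J, where
-- v is a nonzero vector and e ≠ 0 a scalar, and x (T e v) x⁻¹ = T e (x v).  Hence H consists of
-- I and T (± e₀) v₀, and g , h agree on a point exactly if g⁻¹ h = T (± e₀) v for some v.
-- Translate an intersecting set so that it contains I; its members are then T e_i v_i with
-- e_i = ± e₀.  Since (T e v)⁻¹ (T f w) has trace 2 + e f ω(v,w)², any two members satisfy
-- ω(v_i,v_j) = 0 or e_i e_j ω(v_i,v_j)² = −1.  If some ω(v_i,v_j) ≠ 0, then every v_k is a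
-- combination of v_i and v_j with coefficients 0 , ± 1, so the set is small.  Otherwise it lies
-- in one root subgroup {T c v | c ∈ F}.  For odd n, −1 is a nonsquare, so every scalar is ± e₀
-- times a square and the whole root subgroup of order q is intersecting.  For even n, −1 is a
-- square, and the differences of the scalars c must be e₀ times squares; the clique–coclique
-- bound gives at most √q members, and the subfield of order √q, whose elements are norms
-- z^(√q+1) and therefore squares, attains it.
module Submission where

open import Defs hiding (_·_; _≈M_; _~_; det; SL; adj; neg; I₂)
import Defs
open import Algebra.Bundles using (CommutativeMonoid; RawRing)
import Algebra.Solver.Ring
open import Algebra.Solver.Ring.AlmostCommutativeRing using
  (fromCommutativeRing; Induced-equivalence; _-Raw-AlmostCommutative⟶_)
open import Data.Fin.Base using (Fin; zero; suc; toℕ; combine; remQuot)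
open import Data.Fin.Permutation using (permutation)
import Data.Fin.Properties as Fin
open import Data.List.Base using (List; []; _∷_; length; lookup; filter; map; cartesianProduct)
open import Data.List.Membership.Propositional using (_∈_)
open import Data.List.Membership.Propositional.Properties using (∈-lookup; ∈-map⁻)
import Data.List.Properties as List
open import Data.List.Relation.Unary.All as All using (All; []; _∷_)
import Data.List.Relation.Unary.All.Properties as All
open import Data.List.Relation.Unary.AllPairs as AllPairs using (AllPairs; []; _∷_)
import Data.List.Relation.Unary.AllPairs.Properties as AllPairs
open import Data.List.Relation.Unary.Any as Any using (Any; here; there)
import Data.List.Relation.Unary.Any.Properties as Any
open import Data.Maybe.Base using (just; nothing)
open import Data.Nat.Base as ℕ using (ℕ; zero; suc; _≤_; z≤n; s≤s; _^_; _∸_; _%_; _/_)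
open import Data.Nat.DivMod using (m≡m%n+[m/n]*n)
import Data.Nat.Properties as ℕ
open import Data.Nat.Solver using (module +-*-Solver)
open import Data.Product using (∃; _×_; _,_; proj₁; proj₂; uncurry)
open import Data.Sum as Sum using (_⊎_; inj₁; inj₂)
open import Data.Unit using (tt)
open import Function.Base using (_∘_; id; case_of_)
open import Level using (0ℓ)
open import Relation.Binary using (Rel; Symmetric; Decidable; WeaklyDecidable; Setoid; tri<; tri≈; tri>)
open import Relation.Binary.PropositionalEquality as ≡ using (_≡_)
import Relation.Binary.Reasoning.Setoid as SetoidReasoning
open import Relation.Nullary using (¬_; Dec; yes; no; ¬?; contradiction; _×-dec_)
open import Relation.Nullary.Decidable using (map′; decidable-stable)

-- Elements of PSL are matrices up to sign, so a trace is known only up to sign. Since 2 = -1 modulo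
-- 3, a transvection has trace -1, and the two signs produce the two alternatives for ω. When some
-- ω(v_i,v_j) ≠ 0, Cramer's rule gives the coefficients of v_k, and the second alternative fixes
-- their squares up to ratios of the scalars. To conclude that they are 0 or ± 1, different scalars
-- must lie in different square classes. This holds for e₀ and -e₀ when n is odd; it fails when n is
-- even, so there -e₀ is first absorbed into the vector and e₀ alone remains. The independent case
-- thus has at most 2·3·3 = 18 or 1·3·3 = 9 members, to be compared with 3^n or 3^(n/2). This is
-- where n ≥ 3 enters; for n = 4 both sides are 9, so the reduction to one scalar also matters
-- numerically. The field is given as a setoid with an enumeration. Decidable equality, Fermat's
-- theorem, the characteristic, root counts and the subfield are all obtained by counting in that
-- list.

-- Counting in lists of pairwise distinct elements

module _ {A : Set} where

  AllPairs-lookup : {R : Rel A 0ℓ} {xs : List A} → AllPairs R xs →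
                    ∀ {i j} → toℕ i ℕ.< toℕ j → R (lookup xs i) (lookup xs j)
  AllPairs-lookup (px ∷ _)  {zero}  {suc j} _         = All.lookup px (∈-lookup j)
  AllPairs-lookup (_ ∷ pxs) {suc i} {suc j} (s≤s i<j) = AllPairs-lookup pxs i<j

  distinct⇒index-injective : {_~_ : Rel A 0ℓ} → Symmetric _~_ → {xs : List A} →
    AllPairs (λ x y → ¬ x ~ y) xs → ∀ {i j} → lookup xs i ~ lookup xs j → i ≡ j
  distinct⇒index-injective sym distinct {i} {j} i~j with Fin.<-cmp i j
  ... | tri< i<j _ _ = contradiction i~j (AllPairs-lookup distinct i<j)
  ... | tri≈ _ i≡j _ = i≡j
  ... | tri> _ _ j<i = contradiction (sym i~j) (AllPairs-lookup distinct j<i)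

-- A relation replaces a function into `ys` because images are known only up to a setoid equality;
-- the position of the witness in `ys` supplies an honest map between index sets.
pigeonhole : {B : Set} {m : ℕ} {ys : List B} (R : Fin m → B → Set) →
  (∀ {i j y} → R i y → R j y → i ≡ j) → (∀ i → Any (R i) ys) → m ≤ length ys
pigeonhole {ys = ys} R inj cover = Fin.injective⇒≤ {f = λ i → Any.index (cover i)} λ {i} {j} eq →
  inj (Any.lookup-index (cover i))
      (≡.subst (λ k → R j (lookup ys k)) (≡.sym eq) (Any.lookup-index (cover j)))

distinct-pigeonhole : {A B : Set} {_~_ : Rel A 0ℓ} → Symmetric _~_ →
  {xs : List A} {ys : List B} → AllPairs (λ x y → ¬ x ~ y) xs → (R : A → B → Set) →
  (∀ {x x′ y} → R x y → R x′ y → x ~ x′) → All (λ x → Any (R x) ys) xs → length xs ≤ length ys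
distinct-pigeonhole sym {xs} distinct R inj cover = pigeonhole (R ∘ lookup xs)
  (λ r r′ → distinct⇒index-injective sym distinct (inj r r′))
  (λ i → All.lookup cover (∈-lookup i))

module _ {A : Set} {P : A → Set} (P? : ∀ x → Dec (P x)) where

  length-filter-complement : ∀ xs → length xs ≡ length (filter P? xs) ℕ.+ length (filter (¬? ∘ P?) xs)
  length-filter-complement [] = ≡.refl
  length-filter-complement (x ∷ xs) with P? x
  ... | yes _ = ≡.cong suc (length-filter-complement xs)
  ... | no  _ = ≡.trans (≡.cong suc (length-filter-complement xs)) (≡.sym (ℕ.+-suc _ _))

  Any-filter : {Q : A → Set} → (∀ {x} → Q x → P x) → ∀ {xs} → Any Q xs → Any Q (filter P? xs)
  Any-filter Q⇒P {xs} any with Any.filter⁺ P? any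
  ... | inj₁ any′ = any′
  ... | inj₂ ¬P   = contradiction (Q⇒P (Any.lookup-result any)) ¬P

-- Each `y` in turn strips off its fibre, which `bound` limits to `k` elements. Applied to the norm
-- map, this turns an upper bound on fibres into a lower bound on the image.
fibre-count : {A B : Set} {D : Rel A 0ℓ} {Q : B → A → Set} (Q? : ∀ y x → Dec (Q y x)) (k : ℕ) →
  (∀ y zs → AllPairs D zs → All (Q y) zs → length zs ≤ k) →
  ∀ {xs} ys → AllPairs D xs → All (λ x → Any (λ y → Q y x) ys) xs → length xs ≤ length ys ℕ.* k
fibre-count Q? k bound {[]} [] distinct cover = z≤n
fibre-count Q? k bound {x ∷ xs} [] distinct (() ∷ _)
fibre-count {Q = Q} Q? k bound {xs} (y ∷ ys) distinct cover = begin
  length xs                                          ≡⟨ length-filter-complement (Q? y) xs ⟩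
  length (filter (Q? y) xs) ℕ.+ length rest          ≤⟨ ℕ.+-mono-≤
    (bound y _ (AllPairs.filter⁺ (Q? y) distinct) (All.all-filter (Q? y) xs))
    (fibre-count Q? k bound ys (AllPairs.filter⁺ (¬? ∘ Q? y) distinct)
      (All.zipWith (λ { (_ , there any) → any ; (¬q , here q) → contradiction q ¬q })
        (All.all-filter (¬? ∘ Q? y) xs , All.filter⁺ (¬? ∘ Q? y) cover))) ⟩
  k ℕ.+ length ys ℕ.* k ∎
  where
  open ℕ.≤-Reasoning
  rest = filter (¬? ∘ Q? y) xs

-- Translations of a finite set in a commutative monoid

module _ (M : CommutativeMonoid 0ℓ 0ℓ) where
  open CommutativeMonoid M
  open import Algebra.Properties.CommutativeMonoid.Sum M
  open import Algebra.Properties.Monoid.Mult monoid using () renaming (_×_ to _×ᴹ_)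
  open import Relation.Binary.Reasoning.Setoid setoid

  private
    module Translate (xs : List Carrier) (distinct : AllPairs (λ x y → ¬ x ≈ y) xs) where
      shift : ∀ {x} → All (λ u → Any ((x ∙ u) ≈_) xs) xs → Fin (length xs) → Fin (length xs)
      shift closed i = Any.index (All.lookup closed (∈-lookup i))

      shift-lookup : ∀ {x} (closed : All (λ u → Any ((x ∙ u) ≈_) xs) xs) i →
                     x ∙ lookup xs i ≈ lookup xs (shift closed i)
      shift-lookup closed i = Any.lookup-index (All.lookup closed (∈-lookup i))

      shift-inverse : ∀ {x y} → x ∙ y ≈ ε → (closedˣ : All (λ u → Any ((x ∙ u) ≈_) xs) xs)
        (closedʸ : All (λ u → Any ((y ∙ u) ≈_) xs) xs) → ∀ i → shift closedˣ (shift closedʸ i) ≡ i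
      shift-inverse {x} {y} xy≈ε cx cy i = distinct⇒index-injective sym distinct (begin
        lookup xs (shift cx (shift cy i)) ≈⟨ shift-lookup cx _ ⟨
        x ∙ lookup xs (shift cy i)        ≈⟨ ∙-congˡ (shift-lookup cy i) ⟨
        x ∙ (y ∙ lookup xs i)             ≈⟨ assoc x y _ ⟨
        (x ∙ y) ∙ lookup xs i             ≈⟨ ∙-congʳ xy≈ε ⟩
        ε ∙ lookup xs i                   ≈⟨ identityˡ _ ⟩
        lookup xs i                       ∎)

  -- Multiplying the product of all elements by x in each factor permutes the factors.
  order-× : ∀ xs → AllPairs (λ x y → ¬ x ≈ y) xs → ∀ {x y} → x ∙ y ≈ ε →
    All (λ u → Any ((x ∙ u) ≈_) xs) xs → All (λ u → Any ((y ∙ u) ≈_) xs) xs →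
    (∀ u → u ∙ sum (lookup xs) ≈ sum (lookup xs) → u ≈ ε) → length xs ×ᴹ x ≈ ε
  order-× xs distinct {x} {y} xy≈ε cx cy cancel = cancel _ (begin
    (length xs ×ᴹ x) ∙ S                    ≈⟨ ∙-congʳ (sum-replicate (length xs)) ⟨
    sum {length xs} (λ _ → x) ∙ S           ≈⟨ ∑-distrib-+ (λ _ → x) (lookup xs) ⟨
    sum (λ i → x ∙ lookup xs i)             ≈⟨ sum-cong-≋ (shift-lookup cx) ⟩
    sum (λ i → lookup xs (shift cx i))      ≈⟨ sum-permute (lookup xs)
      (permutation (shift cx) (shift cy) (shift-inverse xy≈ε cx cy)
                   (shift-inverse (trans (comm y x) xy≈ε) cy cx)) ⟨
    S                                       ∎)
    where
    open Translate xs distinct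
    S = sum (lookup xs)

-- Finite fields: decidability, Fermat's theorem, characteristic

module FieldTheory {q : ℕ} (F : FiniteField q) where
  open FiniteField F public hiding (zero)
  open import Algebra.Properties.Ring ring public
    using (-0#≈0#; -‿involutive; -1*x≈-x; x∙y⁻¹≈ε⇒x≈y; x≈y⇒x∙y⁻¹≈ε)
  open import Algebra.Properties.CommutativeSemiring.Exp commutativeSemiring public
    using (^-congˡ; ^-homo-*; ^-assocʳ; ^-distrib-*) renaming (_^_ to _↑_)
  open import Relation.Binary.Reasoning.Setoid setoid

  Distinct : List Carrier → Set
  Distinct = AllPairs (λ x y → ¬ x ≈ y)

  elements : List Carrier
  elements = proj₁ card

  length-elements : length elements ≡ q
  length-elements = proj₁ (proj₂ card)

  elements-distinct : Distinct elements
  elements-distinct = proj₁ (proj₂ (proj₂ (proj₂ card)))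

  ∈-elements : ∀ x → Any (x ≈_) elements
  ∈-elements x = proj₂ (proj₂ (proj₂ (proj₂ card))) x tt

  infix 4 _≟_
  -- The equality of the field is a bare setoid relation; positions in the enumeration decide it,
  -- because pairwise distinct entries make the position of an element unique.
  _≟_ : Decidable _≈_
  x ≟ y = map′
    (λ i≡j → trans (Any.lookup-index (∈-elements x))
      (trans (reflexive (≡.cong (lookup elements) i≡j)) (sym (Any.lookup-index (∈-elements y)))))
    (λ x≈y → distinct⇒index-injective sym elements-distinct
      (trans (sym (Any.lookup-index (∈-elements x))) (trans x≈y (Any.lookup-index (∈-elements y)))))
    (Any.index (∈-elements x) Fin.≟ Any.index (∈-elements y))

  search : {P : Carrier → Set} → (∀ {x y} → x ≈ y → P x → P y) → (∀ x → Dec (P x)) → Dec (∃ P)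
  search resp P? = map′ Any.satisfied
    (λ { (x , px) → Any.map (λ x≈y → resp x≈y px) (∈-elements x) }) (Any.any? P? elements)

  distinct-length-≤ : ∀ {xs ys} → Distinct xs → All (λ x → Any (x ≈_) ys) xs → length xs ≤ length ys
  distinct-length-≤ distinct cover =
    distinct-pigeonhole sym distinct _≈_ (λ x≈y x′≈y → trans x≈y (sym x′≈y)) cover

  *-cancelˡ-≉0 : ∀ {x y z} → ¬ x ≈ 0# → x * y ≈ x * z → y ≈ z
  *-cancelˡ-≉0 {x} {y} {z} x≉0 xy≈xz with inverse x x≉0
  ... | w , xw≈1 = begin
    y           ≈⟨ *-identityˡ y ⟨
    1# * y      ≈⟨ *-congʳ (trans (*-comm w x) xw≈1) ⟨
    (w * x) * y ≈⟨ *-assoc w x y ⟩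
    w * (x * y) ≈⟨ *-congˡ xy≈xz ⟩
    w * (x * z) ≈⟨ *-assoc w x z ⟨
    (w * x) * z ≈⟨ *-congʳ (trans (*-comm w x) xw≈1) ⟩
    1# * z      ≈⟨ *-identityˡ z ⟩
    z           ∎

  xy≈0⇒y≈0 : ∀ {x y} → ¬ x ≈ 0# → x * y ≈ 0# → y ≈ 0#
  xy≈0⇒y≈0 x≉0 xy≈0 = *-cancelˡ-≉0 x≉0 (trans xy≈0 (sym (zeroʳ _)))

  xy≈0⇒x≈0⊎y≈0 : ∀ x y → x * y ≈ 0# → x ≈ 0# ⊎ y ≈ 0#
  xy≈0⇒x≈0⊎y≈0 x y xy≈0 with x ≟ 0#
  ... | yes x≈0 = inj₁ x≈0
  ... | no  x≉0 = inj₂ (xy≈0⇒y≈0 x≉0 xy≈0)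

  *-≉0 : ∀ {x y} → ¬ x ≈ 0# → ¬ y ≈ 0# → ¬ x * y ≈ 0#
  *-≉0 x≉0 y≉0 xy≈0 = y≉0 (xy≈0⇒y≈0 x≉0 xy≈0)

  ↑-≉0 : ∀ {x} k → ¬ x ≈ 0# → ¬ x ↑ k ≈ 0#
  ↑-≉0 zero    x≉0 = nontrivial
  ↑-≉0 (suc k) x≉0 = *-≉0 x≉0 (↑-≉0 k x≉0)

  x²≈0⇒x≈0 : ∀ {x} → x * x ≈ 0# → x ≈ 0#
  x²≈0⇒x≈0 {x} xx≈0 with xy≈0⇒x≈0⊎y≈0 x x xx≈0
  ... | inj₁ x≈0 = x≈0
  ... | inj₂ x≈0 = x≈0

  nonzero : List Carrier
  nonzero = filter (λ x → ¬? (x ≟ 0#)) elements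

  nonzero-distinct : Distinct nonzero
  nonzero-distinct = AllPairs.filter⁺ (λ x → ¬? (x ≟ 0#)) elements-distinct

  nonzero-≉0 : All (λ x → ¬ x ≈ 0#) nonzero
  nonzero-≉0 = All.all-filter (λ x → ¬? (x ≟ 0#)) elements

  ∈-nonzero : ∀ {x} → ¬ x ≈ 0# → Any (x ≈_) nonzero
  ∈-nonzero {x} x≉0 = Any-filter (λ x → ¬? (x ≟ 0#)) (λ x≈y y≈0 → x≉0 (trans x≈y y≈0)) (∈-elements x)

  suc-length-nonzero : suc (length nonzero) ≡ q
  suc-length-nonzero = ≡.trans (ℕ.≤-antisym
    (distinct-length-≤ {0# ∷ nonzero}
      (All.map (λ x≉0 0≈x → x≉0 (sym 0≈x)) nonzero-≉0 ∷ nonzero-distinct)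
      (All.tabulate (λ {x} _ → ∈-elements x)))
    (distinct-length-≤ {ys = 0# ∷ nonzero} elements-distinct (All.tabulate (λ {x} _ → cover x))))
    length-elements
    where
    cover : ∀ x → Any (x ≈_) (0# ∷ nonzero)
    cover x with x ≟ 0#
    ... | yes x≈0 = here x≈0
    ... | no  x≉0 = there (∈-nonzero x≉0)

  open import Algebra.Properties.Semiring.Mult semiring using () renaming (_×_ to _×#_; ×1-homo-* to ×#1-homo-*)
  import Algebra.Properties.CommutativeMonoid.Sum as Sums

  -- Additive instance of `order-×`: adding 1 permutes the field, and the sum of all elements is
  -- cancelled by subtraction.
  q×1≈0 : q ×# 1# ≈ 0#
  q×1≈0 = trans (reflexive (≡.cong (_×# 1#) (≡.sym length-elements)))
    (order-× +-commutativeMonoid elements elements-distinct (-‿inverseʳ 1#)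
      (All.tabulate (λ {x} _ → ∈-elements _)) (All.tabulate (λ {x} _ → ∈-elements _))
      (λ u eq → trans (sym (+-identityʳ u)) (trans (+-congˡ (sym (-‿inverseʳ _)))
        (trans (sym (+-assoc u _ _)) (trans (+-congʳ eq) (-‿inverseʳ _))))))

  inverse-≉0 : ∀ {x y} → x * y ≈ 1# → ¬ y ≈ 0#
  inverse-≉0 {x} xy≈1 y≈0 = nontrivial (trans (sym xy≈1) (trans (*-congˡ y≈0) (zeroʳ x)))

  -- Multiplicative instance of `order-×`, on the nonzero elements; their product is nonzero and can
  -- be cancelled.
  fermat : ∀ {x k} → q ≡ suc k → ¬ x ≈ 0# → x ↑ k ≈ 1#
  fermat {x} {k} q≡ x≉0 with inverse x x≉0
  ... | y , xy≈1 = trans (reflexive (≡.cong (x ↑_) (ℕ.suc-injective (≡.trans (≡.sym q≡) (≡.sym suc-length-nonzero)))))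
    (order-× *-commutativeMonoid nonzero nonzero-distinct xy≈1 (closed x≉0) (closed (inverse-≉0 xy≈1))
      (λ u eq → *-cancelˡ-≉0 (product-≉0 (λ i → All.lookup nonzero-≉0 (∈-lookup i)))
        (trans (*-comm _ u) (trans eq (sym (*-identityʳ _))))))
    where
    open Sums *-commutativeMonoid using () renaming (sum to product)
    closed : ∀ {z} → ¬ z ≈ 0# → All (λ u → Any ((z * u) ≈_) nonzero) nonzero
    closed z≉0 = All.map (λ u≉0 → ∈-nonzero (*-≉0 z≉0 u≉0)) nonzero-≉0
    product-≉0 : ∀ {n} {f : Fin n → Carrier} → (∀ i → ¬ f i ≈ 0#) → ¬ product f ≈ 0#
    product-≉0 {zero}  f≉0 = nontrivial
    product-≉0 {suc n} f≉0 = *-≉0 (f≉0 zero) (product-≉0 (f≉0 ∘ suc))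

  -- For q = 3^n, the vanishing element q · 1 is the n-th power of 1 + 1 + 1, and a field has no
  -- nonzero nilpotents.
  char-3 : ∀ n → q ≡ 3 ℕ.^ n → 1# + 1# + 1# ≈ 0#
  char-3 n ≡.refl with (1# + 1# + 1#) ≟ 0#
  ... | yes eq = eq
  ... | no  ≉0 = contradiction (trans (sym (powers n)) q×1≈0) (↑-≉0 n ≉0)
    where
    powers : ∀ n → (3 ℕ.^ n) ×# 1# ≈ (1# + 1# + 1#) ↑ n
    powers zero    = +-identityʳ 1#
    powers (suc n) = trans (×#1-homo-* 3 (3 ℕ.^ n))
      (*-cong (trans (+-congˡ (+-congˡ (+-identityʳ 1#))) (sym (+-assoc 1# 1# 1#))) (powers n))

-- Polynomial identities in characteristic 3

data 𝔽₃ : Set where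
  𝟘 𝟙 -𝟙 : 𝔽₃

-- Coefficients modulo 3 let the ring solver prove identities that hold only in characteristic 3,
-- such as the additivity of cubing.
𝔽₃-rawRing : RawRing 0ℓ 0ℓ
𝔽₃-rawRing = record { Carrier = 𝔽₃ ; _≈_ = _≡_ ; _+_ = add ; _*_ = mul ; -_ = minus ; 0# = 𝟘 ; 1# = 𝟙 }
  where
  add : 𝔽₃ → 𝔽₃ → 𝔽₃
  add 𝟘  y  = y
  add x  𝟘  = x
  add 𝟙 𝟙 = -𝟙
  add 𝟙 -𝟙 = 𝟘
  add -𝟙 𝟙 = 𝟘
  add -𝟙 -𝟙 = 𝟙
  minus : 𝔽₃ → 𝔽₃
  minus 𝟘  = 𝟘
  minus 𝟙 = -𝟙
  minus -𝟙 = 𝟙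
  mul : 𝔽₃ → 𝔽₃ → 𝔽₃
  mul 𝟘  y = 𝟘
  mul 𝟙 y = y
  mul -𝟙 y = minus y

HasCharacteristic3 : ∀ {q} → FiniteField q → Set
HasCharacteristic3 F = 1# + 1# + 1# ≈ 0#
  where open FiniteField F

module Characteristic3 {q : ℕ} (F : FiniteField q)
  (1+1+1≈0 : HasCharacteristic3 F) where

  open FieldTheory F public
  open import Relation.Binary.Reasoning.Setoid setoid

  module Solver where
    private
      ⟦_⟧₃ : 𝔽₃ → Carrier
      ⟦ 𝟘  ⟧₃ = 0#
      ⟦ 𝟙 ⟧₃ = 1#
      ⟦ -𝟙 ⟧₃ = - 1#

      1+1≈-1 : 1# + 1# ≈ - 1#
      1+1≈-1 = trans (sym (+-identityʳ _)) (trans (+-congˡ (sym (-‿inverseʳ 1#)))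
        (trans (sym (+-assoc _ _ _)) (trans (+-congʳ 1+1+1≈0) (+-identityˡ _))))

      -1-1≈1 : - 1# + - 1# ≈ 1#
      -1-1≈1 = trans (+-congʳ (sym 1+1≈-1)) (trans (+-assoc _ _ _)
        (trans (+-congˡ (-‿inverseʳ 1#)) (+-identityʳ 1#)))

      morphism : 𝔽₃-rawRing -Raw-AlmostCommutative⟶ fromCommutativeRing cring
      morphism = record
        { ⟦_⟧    = ⟦_⟧₃
        ; +-homo = λ { 𝟘 y → sym (+-identityˡ _) ; 𝟙 𝟘 → sym (+-identityʳ _) ; -𝟙 𝟘 → sym (+-identityʳ _)
                     ; 𝟙 𝟙 → sym 1+1≈-1 ; 𝟙 -𝟙 → sym (-‿inverseʳ 1#) ; -𝟙 𝟙 → sym (-‿inverseˡ 1#)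
                     ; -𝟙 -𝟙 → sym -1-1≈1 }
        ; *-homo = λ { 𝟘 y → sym (zeroˡ _) ; 𝟙 y → sym (*-identityˡ _) ; -𝟙 𝟘 → sym (zeroʳ _)
                     ; -𝟙 𝟙 → sym (*-identityʳ _)
                     ; -𝟙 -𝟙 → sym (trans (-1*x≈-x (- 1#)) (-‿involutive 1#)) }
        ; -‿homo = λ { 𝟘 → sym -0#≈0# ; 𝟙 → refl ; -𝟙 → sym (-‿involutive 1#) }
        ; 0-homo = refl
        ; 1-homo = refl
        }

      decide : WeaklyDecidable (Induced-equivalence morphism)
      decide 𝟘  𝟘  = just refl
      decide 𝟙  𝟙  = just refl
      decide -𝟙 -𝟙 = just refl
      decide _  _  = nothing

    open Algebra.Solver.Ring 𝔽₃-rawRing (fromCommutativeRing cring) morphism decide public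
      using (solve; _:=_; _:+_; _:*_; _:-_; :-_; con)
  open Solver

  x-y≈0⇒x≈y : ∀ {x y} → x - y ≈ 0# → x ≈ y
  x-y≈0⇒x≈y {x} {y} = x∙y⁻¹≈ε⇒x≈y x y

  x≈y⇒x-y≈0 : ∀ {x y} → x ≈ y → x - y ≈ 0#
  x≈y⇒x-y≈0 {x} {y} = x≈y⇒x∙y⁻¹≈ε

  -- Modulo 3, x = -2x, and the hypothesis makes 2x vanish.
  x≈-x⇒x≈0 : ∀ {x} → x ≈ - x → x ≈ 0#
  x≈-x⇒x≈0 {x} x≈-x = trans (solve 1 (λ x → x := :- (x :- (:- x))) refl x)
    (trans (-‿cong (x≈y⇒x-y≈0 x≈-x)) -0#≈0#)

  x²≈y²⇒x≈±y : ∀ {x y} → x * x ≈ y * y → x ≈ y ⊎ x ≈ - y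
  x²≈y²⇒x≈±y {x} {y} eq = Sum.map x-y≈0⇒x≈y (λ s → x-y≈0⇒x≈y (trans (+-congˡ (-‿involutive y)) s))
    (xy≈0⇒x≈0⊎y≈0 (x - y) (x + y) (trans (solve 2 (λ x y → (x :- y) :* (x :+ y) := x :* x :- y :* y) refl x y)
      (x≈y⇒x-y≈0 eq)))

  x²≈1⇒x≈±1 : ∀ {x} → x * x ≈ 1# → x ≈ 1# ⊎ x ≈ - 1#
  x²≈1⇒x≈±1 eq = x²≈y²⇒x≈±y (trans eq (sym (*-identityˡ 1#)))

  -- Polynomial functions and their roots

  -- f is a polynomial function of degree at most k with coefficient l at degree k,
  -- expressed through its divided differences.
  Poly : ℕ → Carrier → (Carrier → Carrier) → Set
  Poly zero    l f = ∀ x → f x ≈ l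
  Poly (suc k) l f = ∀ c → ∃ λ g → Poly k l g × (∀ x → f x ≈ f c + (x - c) * g x)

  Poly-resp : ∀ k {l l′ f} → l ≈ l′ → Poly k l f → Poly k l′ f
  Poly-resp zero    l≈l′ p x = trans (p x) l≈l′
  Poly-resp (suc k) l≈l′ p c with p c
  ... | g , pg , eq = g , Poly-resp k l≈l′ pg , eq

  Poly-raise : ∀ k {l f} → Poly k l f → Poly (suc k) 0# f
  Poly-raise zero {l} {f} p c = (λ _ → 0#) , (λ _ → refl) , λ x → begin
    f x                    ≈⟨ trans (p x) (sym (p c)) ⟩
    f c                    ≈⟨ solve 2 (λ u v → u := u :+ v :* con 𝟘) refl (f c) (x - c) ⟩
    f c + (x - c) * 0#     ∎
  Poly-raise (suc k) p c with p c
  ... | g , pg , eq = g , Poly-raise k pg , eq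

  Poly-+ : ∀ k {l l′ f f′} → Poly k l f → Poly k l′ f′ → Poly k (l + l′) (λ x → f x + f′ x)
  Poly-+ zero    p p′ x = +-cong (p x) (p′ x)
  Poly-+ (suc k) {f = f} {f′} p p′ c with p c | p′ c
  ... | g , pg , eq | g′ , pg′ , eq′ = _ , Poly-+ k pg pg′ , λ x → trans (+-cong (eq x) (eq′ x))
    (solve 5 (λ a b d u v → (a :+ d :* u) :+ (b :+ d :* v) := (a :+ b) :+ d :* (u :+ v))
      refl (f c) (f′ c) (x - c) (g x) (g′ x))

  Poly-scale : ∀ k {l f} a → Poly k l f → Poly k (a * l) (λ x → a * f x)
  Poly-scale zero    a p x = *-congˡ (p x)
  Poly-scale (suc k) {f = f} a p c with p c
  ... | g , pg , eq = _ , Poly-scale k a pg , λ x → trans (*-congˡ (eq x))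
    (solve 4 (λ a b d u → a :* (b :+ d :* u) := a :* b :+ d :* (a :* u)) refl a (f c) (x - c) (g x))

  -- If g is the divided difference of f at c, that of x f(x) is f(x) + c g(x). The second summand
  -- has lower degree, so raising it with coefficient 0 leaves the leading coefficient `l`
  -- unchanged.
  Poly-x* : ∀ k {l f} → Poly k l f → Poly (suc k) l (λ x → x * f x)
  Poly-x* zero {l} {f} p c = f , p , λ x → trans
    (solve 3 (λ x c u → x :* u := c :* u :+ (x :- c) :* u) refl x c (f x))
    (+-congʳ (*-congˡ (trans (p x) (sym (p c)))))
  Poly-x* (suc k) {l} {f} p c with p c
  ... | g , pg , eq = (λ x → f x + c * g x) ,
    Poly-resp (suc k) (+-identityʳ l) (Poly-+ (suc k) p (Poly-raise k (Poly-scale k c pg))) , λ x → begin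
      x * f x                                          ≈⟨ solve 4 (λ x c u w →
        x :* u := c :* w :+ (x :- c) :* u :+ c :* (u :- w)) refl x c (f x) (f c) ⟩
      c * f c + (x - c) * f x + c * (f x - f c)        ≈⟨ +-congˡ (*-congˡ (+-congʳ (eq x))) ⟩
      c * f c + (x - c) * f x + c * (f c + (x - c) * g x - f c) ≈⟨ solve 5 (λ x c u w v →
        c :* w :+ (x :- c) :* u :+ c :* (w :+ (x :- c) :* v :- w) := c :* w :+ (x :- c) :* (u :+ c :* v))
        refl x c (f x) (f c) (g x) ⟩
      c * f c + (x - c) * (f x + c * g x)              ∎

  Poly-↑ : ∀ k → Poly k 1# (_↑ k)
  Poly-↑ zero    x = refl
  Poly-↑ (suc k) = Poly-x* k (Poly-↑ k)

  Poly-↑-const : ∀ k c → Poly (suc k) 1# (λ x → x ↑ suc k + c)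
  Poly-↑-const k c = Poly-resp (suc k) (+-identityʳ 1#)
    (Poly-+ (suc k) {f = _↑ suc k} {λ _ → c} (Poly-↑ (suc k)) (constant k))
    where
    constant : ∀ k → Poly (suc k) 0# (λ _ → c)
    constant zero    = Poly-raise zero {f = λ _ → c} (λ _ → refl)
    constant (suc k) = Poly-raise (suc k) {f = λ _ → c} (constant k)

  -- Splitting off the root `z` passes to the divided difference at `z`, which keeps the leading
  -- coefficient and lowers the degree; all other roots survive because there are no zero divisors.
  root-count : ∀ k {l f} → Poly k l f → ¬ l ≈ 0# →
    ∀ {zs} → Distinct zs → All (λ z → f z ≈ 0#) zs → length zs ≤ k
  root-count k       p l≉0 [] [] = z≤n
  root-count zero    p l≉0 (_ ∷ _) (fz ∷ _) = contradiction (trans (sym (p _)) fz) l≉0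
  root-count (suc k) {f = f} p l≉0 {z ∷ zs} (z≉ ∷ distinct) (fz ∷ fzs) with p z
  ... | g , pg , eq = s≤s (root-count k pg l≉0 distinct (All.zipWith root (z≉ , fzs)))
    where
    root : ∀ {x} → ¬ z ≈ x × f x ≈ 0# → g x ≈ 0#
    root {x} (z≉x , fx) = xy≈0⇒y≈0 (λ x-z≈0 → z≉x (sym (x-y≈0⇒x≈y x-z≈0))) (begin
      (x - z) * g x         ≈⟨ +-identityˡ _ ⟨
      0# + (x - z) * g x    ≈⟨ +-congʳ fz ⟨
      f z + (x - z) * g x   ≈⟨ eq x ⟨
      f x                   ≈⟨ fx ⟩
      0#                    ∎)

  -- Squares when q is 3 modulo 4

  IsSquare : Carrier → Set
  IsSquare x = ∃ λ y → y * y ≈ x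

  IsSquare-resp : ∀ {x y} → x ≈ y → IsSquare x → IsSquare y
  IsSquare-resp x≈y (s , ss≈x) = s , trans ss≈x x≈y

  isSquare? : ∀ x → Dec (IsSquare x)
  isSquare? x = search (λ y≈z yy≈x → trans (*-cong (sym y≈z) (sym y≈z)) yy≈x) (λ y → y * y ≟ x)

  ↑-double : ∀ x k → x ↑ (k ℕ.* 2) ≈ x ↑ k * x ↑ k
  ↑-double x k = trans (sym (^-assocʳ x k 2)) (*-congˡ (*-identityʳ _))

  1↑ : ∀ k → 1# ↑ k ≈ 1#
  1↑ zero    = refl
  1↑ (suc k) = trans (*-identityˡ _) (1↑ k)

  module q≡3mod4 (j : ℕ) (q≡ : q ≡ 3 ℕ.+ 4 ℕ.* j) where
    private
      q-1 : q ≡ suc (suc (j ℕ.* 2) ℕ.* 2)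
      q-1 = ≡.trans q≡ (≡.cong (3 ℕ.+_) (≡.trans (ℕ.*-comm 4 j) (≡.sym (ℕ.*-assoc j 2 2))))

    -- (q - 1)/2 = 2j + 1 is odd, so the power q - 1 of a square root of -1 would be -1, whereas
    -- Fermat makes it 1.
    -1-nonsquare : ¬ IsSquare (- 1#)
    -1-nonsquare (i , i²≈-1) = nontrivial (x≈-x⇒x≈0 (begin
      1#                                   ≈⟨ fermat q-1 i≉0 ⟨
      i ↑ (suc (j ℕ.* 2) ℕ.* 2)            ≈⟨ ↑-double i (suc (j ℕ.* 2)) ⟩
      i ↑ suc (j ℕ.* 2) * i ↑ suc (j ℕ.* 2) ≈⟨ ^-distrib-* i i (suc (j ℕ.* 2)) ⟨
      (i * i) ↑ suc (j ℕ.* 2)              ≈⟨ ^-congˡ (suc (j ℕ.* 2)) i²≈-1 ⟩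
      - 1# * (- 1#) ↑ (j ℕ.* 2)            ≈⟨ *-congˡ (trans (↑-double (- 1#) j) (trans (sym (^-distrib-* (- 1#) (- 1#) j))
        (trans (^-congˡ j (trans (-1*x≈-x _) (-‿involutive 1#))) (1↑ j)))) ⟩
      - 1# * 1#                            ≈⟨ *-identityʳ _ ⟩
      - 1#                                 ∎))
      where
      i≉0 : ¬ i ≈ 0#
      i≉0 i≈0 = nontrivial (trans (sym (-‿involutive 1#)) (trans (-‿cong (trans (sym i²≈-1)
        (trans (*-congʳ i≈0) (zeroˡ i)))) -0#≈0#))

    -- The root is x^((q+1)/4), with (q + 1)/4 = j + 1: its square is x · x^((q-1)/2), and the last
    -- factor is ± 1 because its square is 1 by Fermat.
    ±square : ∀ x → IsSquare x ⊎ IsSquare (- x)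
    ±square x with x ≟ 0#
    ... | yes x≈0 = inj₁ (0# , trans (zeroˡ _) (sym x≈0))
    ... | no  x≉0 = Sum.map
      (λ s≈1 → root , trans root² (trans (*-congˡ s≈1) (*-identityʳ x)))
      (λ s≈-1 → root , trans root² (trans (*-congˡ s≈-1) (trans (*-comm x _) (-1*x≈-x x))))
      (x²≈1⇒x≈±1 (trans (sym (↑-double x (suc (j ℕ.* 2)))) (fermat q-1 x≉0)))
      where
      root = x ↑ suc j
      root² : root * root ≈ x * x ↑ suc (j ℕ.* 2)
      root² = sym (↑-double x (suc j))

  -- Frobenius, the subfield of order √q and its norms

  frobenius : ∀ m x y → (x - y) ↑ (3 ℕ.^ m) ≈ x ↑ (3 ℕ.^ m) - y ↑ (3 ℕ.^ m)
  frobenius zero    x y = solve 2 (λ x y → (x :- y) :* con 𝟙 := x :* con 𝟙 :- y :* con 𝟙) refl x y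
  frobenius (suc m) x y = begin
    (x - y) ↑ (3 ℕ.* 3 ℕ.^ m)                        ≈⟨ ^-assocʳ (x - y) 3 (3 ℕ.^ m) ⟨
    -- The mixed terms of the cube carry the coefficient 3 = 0.
    ((x - y) ↑ 3) ↑ (3 ℕ.^ m)                        ≈⟨ ^-congˡ (3 ℕ.^ m) (solve 2 (λ x y →
      (x :- y) :* ((x :- y) :* ((x :- y) :* con 𝟙)) := x :* (x :* (x :* con 𝟙)) :- y :* (y :* (y :* con 𝟙))) refl x y) ⟩
    (x ↑ 3 - y ↑ 3) ↑ (3 ℕ.^ m)                      ≈⟨ frobenius m (x ↑ 3) (y ↑ 3) ⟩
    (x ↑ 3) ↑ (3 ℕ.^ m) - (y ↑ 3) ↑ (3 ℕ.^ m)        ≈⟨ +-cong (^-assocʳ x 3 (3 ℕ.^ m)) (-‿cong (^-assocʳ y 3 (3 ℕ.^ m))) ⟩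
    x ↑ (3 ℕ.* 3 ℕ.^ m) - y ↑ (3 ℕ.* 3 ℕ.^ m)        ∎

  module q≡r² (m j : ℕ) (r≡ : 3 ℕ.^ m ≡ suc (suc j ℕ.* 2)) (q≡ : q ≡ 3 ℕ.^ m ℕ.* 3 ℕ.^ m) where
    private
      -- Writing r = 3^m, this is r - 1. Hence `2 ℕ.+ p` is r + 1, and q - 1 = (r + 1)(r - 1).
      p = suc j ℕ.* 2

      q-1 : q ≡ suc ((2 ℕ.+ p) ℕ.* p)
      q-1 = ≡.trans q≡ (≡.trans (≡.cong₂ ℕ._*_ r≡ r≡)
        (≡.cong suc (≡.cong (p ℕ.+_) (≡.trans (ℕ.*-suc p p) ≡.refl))))

    length-nonzero : length nonzero ≡ (2 ℕ.+ p) ℕ.* p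
    length-nonzero = ℕ.suc-injective (≡.trans suc-length-nonzero q-1)

    InSubfield : Carrier → Set
    InSubfield x = x ↑ (3 ℕ.^ m) ≈ x

    InSubfield-0 : InSubfield 0#
    InSubfield-0 = trans (reflexive (≡.cong (0# ↑_) r≡)) (zeroˡ _)

    InSubfield-difference : ∀ {x y} → InSubfield x → InSubfield y → InSubfield (x - y)
    InSubfield-difference {x} {y} kx ky = trans (frobenius m x y) (+-cong kx (-‿cong ky))

    -- The elements are roots of X^r - X. The term -X is entered with coefficient 0 in degree r, so
    -- the leading coefficient stays nonzero.
    subfield-count : ∀ {zs} → Distinct zs → All InSubfield zs → length zs ≤ 3 ℕ.^ m
    subfield-count distinct ks = ≡.subst (_ ≤_) (≡.sym r≡)
      (root-count (suc p) {f = λ x → x ↑ suc p + - 1# * x ↑ 1}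
        (Poly-+ (suc p) {f = _↑ suc p} {λ x → - 1# * x ↑ 1} (Poly-↑ (suc p))
          (Poly-scale (suc p) {0#} {_↑ 1} (- 1#) (raise (suc (j ℕ.* 2))))) leading≉0 distinct
        (All.map (λ {x} kx → trans (+-congʳ (trans (reflexive (≡.cong (x ↑_) (≡.sym r≡))) kx))
          (solve 1 (λ x → x :+ (:- con 𝟙) :* (x :* con 𝟙) := con 𝟘) refl x)) ks))
      where
      raise : ∀ k → Poly (2 ℕ.+ k) 0# (_↑ 1)
      raise zero    = Poly-raise 1 {1#} {_↑ 1} (Poly-↑ 1)
      raise (suc k) = Poly-raise (2 ℕ.+ k) {0#} {_↑ 1} (raise k)
      leading≉0 : ¬ 1# + - 1# * 0# ≈ 0#
      leading≉0 eq = nontrivial (trans (solve 0 (con 𝟙 := con 𝟙 :+ (:- con 𝟙) :* con 𝟘) refl) eq)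

    -- z^(r+1) = z · z^r, the relative norm to the fixed field of z ↦ z^r.
    norm : Carrier → Carrier
    norm z = z ↑ (2 ℕ.+ p)

    IsNorm : Carrier → Set
    IsNorm x = ∃ λ z → ¬ z ≈ 0# × norm z ≈ x

    isNorm? : ∀ x → Dec (IsNorm x)
    isNorm? x = search
      (λ y≈z (y≉0 , ny) → (λ z≈0 → y≉0 (trans y≈z z≈0)) , trans (^-congˡ (2 ℕ.+ p) (sym y≈z)) ny)
      (λ z → ¬? (z ≟ 0#) ×-dec (norm z ≟ x))

    IsNorm-resp : ∀ {x y} → x ≈ y → IsNorm x → IsNorm y
    IsNorm-resp x≈y (z , z≉0 , nz) = z , z≉0 , trans nz x≈y

    norms : List Carrier
    norms = filter isNorm? nonzero

    norm≉0 : ∀ {z} → ¬ z ≈ 0# → ¬ norm z ≈ 0#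
    norm≉0 = ↑-≉0 (2 ℕ.+ p)

    ∈-norms : ∀ {x} → IsNorm x → Any (x ≈_) norms
    ∈-norms n@(z , z≉0 , nz) = Any-filter isNorm? (λ x≈y → IsNorm-resp x≈y n)
      (∈-nonzero (λ x≈0 → norm≉0 z≉0 (trans nz x≈0)))

    -- A fibre of the norm consists of roots of X^(r+1) - y, so it has at most r + 1 elements; the
    -- (r + 1)(r - 1) nonzero elements therefore have at least r - 1 norms.
    p≤length-norms : p ≤ length norms
    p≤length-norms = ℕ.*-cancelʳ-≤ p (length norms) (2 ℕ.+ p) (≡.subst (_≤ length norms ℕ.* (2 ℕ.+ p))
      (≡.trans length-nonzero (ℕ.*-comm (2 ℕ.+ p) p))
      (fibre-count {Q = λ y z → norm z ≈ y} (λ y z → norm z ≟ y) (2 ℕ.+ p)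
        (λ y zs distinct all → root-count (2 ℕ.+ p) {f = λ z → norm z + - y} (Poly-↑-const (suc p) (- y)) nontrivial distinct
          (All.map x≈y⇒x-y≈0 all))
        norms nonzero-distinct
        (All.map (λ {z} z≉0 → ∈-norms (z , z≉0 , refl)) nonzero-≉0)))

    -- x^(r-1) = z^(q-1) = 1 by Fermat.
    IsNorm⇒InSubfield : ∀ {x} → IsNorm x → InSubfield x
    IsNorm⇒InSubfield {x} (z , z≉0 , nz) = begin
      x ↑ (3 ℕ.^ m)          ≈⟨ reflexive (≡.cong (x ↑_) r≡) ⟩
      x * x ↑ p              ≈⟨ *-congˡ (^-congˡ p nz) ⟨
      x * norm z ↑ p         ≈⟨ *-congˡ (trans (^-assocʳ z (2 ℕ.+ p) p) (fermat q-1 z≉0)) ⟩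
      x * 1#                 ≈⟨ *-identityʳ x ⟩
      x                      ∎

    subfield : List Carrier
    subfield = 0# ∷ norms

    subfield-distinct : Distinct subfield
    subfield-distinct = All.map (λ { (z , z≉0 , nz) 0≈x → norm≉0 z≉0 (trans nz (sym 0≈x)) })
      (All.all-filter isNorm? nonzero) ∷ AllPairs.filter⁺ isNorm? nonzero-distinct

    subfield-InSubfield : All InSubfield subfield
    subfield-InSubfield = InSubfield-0 ∷ All.map IsNorm⇒InSubfield (All.all-filter isNorm? nonzero)

    length-subfield : length subfield ≡ 3 ℕ.^ m
    length-subfield = ℕ.≤-antisym (subfield-count subfield-distinct subfield-InSubfield)
      (≡.subst (_≤ length subfield) (≡.sym r≡) (s≤s p≤length-norms))

    -- The norms together with 0 already exhaust the r elements of the subfield.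
    InSubfield⇒IsNorm : ∀ {x} → ¬ x ≈ 0# → InSubfield x → IsNorm x
    InSubfield⇒IsNorm {x} x≉0 kx with isNorm? x
    ... | yes n = n
    ... | no ¬n = contradiction
      (subfield-count {x ∷ subfield}
        ((x≉0 ∷ All.map (λ n x≈y → ¬n (IsNorm-resp (sym x≈y) n)) (All.all-filter isNorm? nonzero)) ∷ subfield-distinct)
        (kx ∷ subfield-InSubfield))
      (ℕ.<⇒≱ (≡.subst (3 ℕ.^ m ℕ.<_) (≡.cong suc (≡.sym length-subfield)) ℕ.≤-refl))

    InSubfield⇒IsSquare : ∀ {x} → InSubfield x → IsSquare x
    InSubfield⇒IsSquare {x} kx with x ≟ 0#
    ... | yes x≈0 = 0# , trans (zeroˡ _) (sym x≈0)
    ... | no  x≉0 with InSubfield⇒IsNorm x≉0 kx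
    -- The exponent r + 1 equals 2 (2 + j).
    ...   | z , _ , nz = z ↑ (2 ℕ.+ j) , trans (sym (↑-double z (2 ℕ.+ j))) nz

    -1-square : IsSquare (- 1#)
    -1-square = IsSquare-resp (+-identityˡ (- 1#)) (InSubfield⇒IsSquare (InSubfield-difference InSubfield-0 (1↑ (3 ℕ.^ m))))

    subfield-difference-square : ∀ {x y} → x ∈ subfield → y ∈ subfield → IsSquare (x - y)
    subfield-difference-square x∈ y∈ = InSubfield⇒IsSquare
      (InSubfield-difference (All.lookup subfield-InSubfield x∈) (All.lookup subfield-InSubfield y∈))

    -- Otherwise every nonzero z = y² would satisfy z^k = y^(q-1) = 1 for k = (q - 1)/2, giving a
    -- polynomial of degree k with 2k roots.
    nonsquare : ∃ λ t → ¬ IsSquare t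
    nonsquare with search (λ x≈y ¬sq sq → ¬sq (IsSquare-resp (sym x≈y) sq)) (λ x → ¬? (isSquare? x))
    ... | yes ns = ns
    ... | no ¬ns = contradiction
      (root-count k {f = λ z → z ↑ k + - 1#} (Poly-↑-const (ℕ.pred k) (- 1#)) nontrivial nonzero-distinct
        (All.map (λ {z} z≉0 → x≈y⇒x-y≈0 (roots z≉0)) nonzero-≉0))
      (ℕ.<⇒≱ (≡.subst (k ℕ.<_) (≡.sym (≡.trans length-nonzero half)) (ℕ.m<m+n k (s≤s z≤n))))
      where
      k = suc j ℕ.* (2 ℕ.+ p)
      half : (2 ℕ.+ p) ℕ.* p ≡ k ℕ.+ k
      half = ≡.trans (ℕ.*-comm (2 ℕ.+ p) p) (≡.trans (≡.cong (ℕ._* (2 ℕ.+ p)) (ℕ.*-comm (suc j) 2))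
        (≡.trans (ℕ.*-assoc 2 (suc j) (2 ℕ.+ p)) (≡.cong (k ℕ.+_) (ℕ.+-identityʳ k))))
      roots : ∀ {z} → ¬ z ≈ 0# → z ↑ k ≈ 1#
      roots {z} z≉0 with decidable-stable (isSquare? z) (λ ¬sq → ¬ns (z , ¬sq))
      ... | y , y²≈z = begin
        z ↑ k              ≈⟨ ^-congˡ k y²≈z ⟨
        (y * y) ↑ k        ≈⟨ ^-distrib-* y y k ⟩
        y ↑ k * y ↑ k      ≈⟨ ^-homo-* y k k ⟨
        y ↑ (k ℕ.+ k)      ≈⟨ reflexive (≡.cong (y ↑_) half) ⟨
        y ↑ ((2 ℕ.+ p) ℕ.* p) ≈⟨ fermat q-1 (λ y≈0 → z≉0 (trans (sym y²≈z) (trans (*-congʳ y≈0) (zeroˡ y)))) ⟩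
        1#                 ∎

-- Matrices up to sign and transvections

module SpecialLinear {q : ℕ} (F : FiniteField q)
  (1+1+1≈0 : HasCharacteristic3 F) where

  open Characteristic3 F 1+1+1≈0 public
  open Solver
  open Mat {F = F} public

  infixl 7 _∙_
  infix 4 _≈M_ _∼_

  opaque
    _∙_ : Mat F → Mat F → Mat F
    _∙_ = Defs._·_ F

    adj neg : Mat F → Mat F
    adj = Defs.adj F
    neg = Defs.neg F

    -- The transvection I + e v vᵀ J with v = (p , s) and J = (0 1 ; -1 0).
    T : Carrier → Carrier → Carrier → Mat F
    T e p s = mat (1# - e * (p * s)) (e * (p * p)) (- (e * (s * s))) (1# + e * (p * s))

  -- The relations are data types and the operations opaque, so that matrices stay inferable from them.
  record _≈M_ (m n : Mat F) : Set where
    constructor entries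
    field entrywise : Defs._≈M_ F m n

  data _∼_ (m n : Mat F) : Set where
    plus  : m ≈M n → m ∼ n
    minus : m ≈M neg n → m ∼ n

  I : Mat F
  I = Defs.I₂ F

  det tr : Mat F → Carrier
  det = Defs.det F
  tr m = a m + d m

  SL : Mat F → Set
  SL = Defs.SL F

  ≈M-refl : ∀ {m} → m ≈M m
  ≈M-refl = entries (refl , refl , refl , refl)

  ≈M-sym : ∀ {m n} → m ≈M n → n ≈M m
  ≈M-sym (entries (α , β , γ , δ)) = entries (sym α , sym β , sym γ , sym δ)

  ≈M-trans : ∀ {m n o} → m ≈M n → n ≈M o → m ≈M o
  ≈M-trans (entries (α , β , γ , δ)) (entries (α′ , β′ , γ′ , δ′)) =
    entries (trans α α′ , trans β β′ , trans γ γ′ , trans δ δ′)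

  opaque
    unfolding _∙_ adj neg T

    neg-cong : ∀ {m n} → m ≈M n → neg m ≈M neg n
    neg-cong (entries (α , β , γ , δ)) = entries (-‿cong α , -‿cong β , -‿cong γ , -‿cong δ)

    neg-involutive : ∀ m → neg (neg m) ≈M m
    neg-involutive m = entries (-‿involutive _ , -‿involutive _ , -‿involutive _ , -‿involutive _)

    ∙-cong : ∀ {m m′ n n′} → m ≈M m′ → n ≈M n′ → m ∙ n ≈M m′ ∙ n′
    ∙-cong (entries (α , β , γ , δ)) (entries (α′ , β′ , γ′ , δ′)) = entries
      (+-cong (*-cong α α′) (*-cong β γ′) , +-cong (*-cong α β′) (*-cong β δ′) ,
      +-cong (*-cong γ α′) (*-cong δ γ′) , +-cong (*-cong γ β′) (*-cong δ δ′))

    ∙-assoc : ∀ m n o → (m ∙ n) ∙ o ≈M m ∙ (n ∙ o)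
    ∙-assoc m n o = entries (entry (a m) (b m) (a o) (c o) , entry (a m) (b m) (b o) (d o) ,
                    entry (c m) (d m) (a o) (c o) , entry (c m) (d m) (b o) (d o))
      where
      entry : ∀ x y u v → (x * a n + y * c n) * u + (x * b n + y * d n) * v ≈
                          x * (a n * u + b n * v) + y * (c n * u + d n * v)
      entry x y u v = solve 8 (λ x y u v a b c d →
        (x :* a :+ y :* c) :* u :+ (x :* b :+ y :* d) :* v := x :* (a :* u :+ b :* v) :+ y :* (c :* u :+ d :* v))
        refl x y u v (a n) (b n) (c n) (d n)

    ∙-identityˡ : ∀ m → I ∙ m ≈M m
    ∙-identityˡ m = entries (one (a m) (c m) , one (b m) (d m) , two (a m) (c m) , two (b m) (d m))
      where
      one : ∀ x y → 1# * x + 0# * y ≈ x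
      one = solve 2 (λ x y → con 𝟙 :* x :+ con 𝟘 :* y := x) refl
      two : ∀ x y → 0# * x + 1# * y ≈ y
      two = solve 2 (λ x y → con 𝟘 :* x :+ con 𝟙 :* y := y) refl

    ∙-identityʳ : ∀ m → m ∙ I ≈M m
    ∙-identityʳ m = entries (one (a m) (b m) , two (a m) (b m) , one (c m) (d m) , two (c m) (d m))
      where
      one : ∀ x y → x * 1# + y * 0# ≈ x
      one = solve 2 (λ x y → x :* con 𝟙 :+ y :* con 𝟘 := x) refl
      two : ∀ x y → x * 0# + y * 1# ≈ y
      two = solve 2 (λ x y → x :* con 𝟘 :+ y :* con 𝟙 := y) refl

    adj-inverseˡ : ∀ {m} → SL m → adj m ∙ m ≈M I
    adj-inverseˡ {mat a b c d} det≈1 = entries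
      (trans (solve 4 (λ a b c d → d :* a :+ (:- b) :* c := a :* d :- b :* c) refl a b c d) det≈1 ,
      solve 2 (λ b d → d :* b :+ (:- b) :* d := con 𝟘) refl b d ,
      solve 2 (λ a c → (:- c) :* a :+ a :* c := con 𝟘) refl a c ,
      trans (solve 4 (λ a b c d → (:- c) :* b :+ a :* d := a :* d :- b :* c) refl a b c d) det≈1)

    adj-inverseʳ : ∀ {m} → SL m → m ∙ adj m ≈M I
    adj-inverseʳ {mat a b c d} det≈1 = entries
      (trans (solve 4 (λ a b c d → a :* d :+ b :* (:- c) := a :* d :- b :* c) refl a b c d) det≈1 ,
      solve 2 (λ a b → a :* (:- b) :+ b :* a := con 𝟘) refl a b ,
      solve 2 (λ c d → c :* d :+ d :* (:- c) := con 𝟘) refl c d ,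
      trans (solve 4 (λ a b c d → c :* (:- b) :+ d :* a := a :* d :- b :* c) refl a b c d) det≈1)

    det-∙ : ∀ m n → det (m ∙ n) ≈ det m * det n
    det-∙ (mat a b c d) (mat a′ b′ c′ d′) = solve 8 (λ a b c d a′ b′ c′ d′ →
      (a :* a′ :+ b :* c′) :* (c :* b′ :+ d :* d′) :- (a :* b′ :+ b :* d′) :* (c :* a′ :+ d :* c′)
      := (a :* d :- b :* c) :* (a′ :* d′ :- b′ :* c′)) refl a b c d a′ b′ c′ d′

  SL-∙ : ∀ {m n} → SL m → SL n → SL (m ∙ n)
  SL-∙ {m} {n} sm sn = trans (det-∙ m n) (trans (*-cong sm sn) (*-identityˡ 1#))

  opaque
    unfolding _∙_ adj neg T

    SL-adj : ∀ {m} → SL m → SL (adj m)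
    SL-adj {mat a b c d} sm = trans (solve 4 (λ a b c d → d :* a :- (:- b) :* (:- c) := a :* d :- b :* c) refl a b c d) sm

  SL-I : SL I
  SL-I = solve 0 (con 𝟙 :* con 𝟙 :- con 𝟘 :* con 𝟘 := con 𝟙) refl

  opaque
    unfolding _∙_ adj neg T

    SL-neg : ∀ {m} → SL m → SL (neg m)
    SL-neg {mat a b c d} sm = trans (solve 4 (λ a b c d → (:- a) :* (:- d) :- (:- b) :* (:- c) := a :* d :- b :* c) refl a b c d) sm

    neg-∙ˡ : ∀ m n → neg m ∙ n ≈M neg (m ∙ n)
    neg-∙ˡ m n = entries (entry _ _ _ _ , entry _ _ _ _ , entry _ _ _ _ , entry _ _ _ _)
      where
      entry : ∀ x y u v → - x * u + - y * v ≈ - (x * u + y * v)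
      entry = solve 4 (λ x y u v → (:- x) :* u :+ (:- y) :* v := :- (x :* u :+ y :* v)) refl

    neg-∙ʳ : ∀ m n → m ∙ neg n ≈M neg (m ∙ n)
    neg-∙ʳ m n = entries (entry _ _ _ _ , entry _ _ _ _ , entry _ _ _ _ , entry _ _ _ _)
      where
      entry : ∀ x y u v → x * - u + y * - v ≈ - (x * u + y * v)
      entry = solve 4 (λ x y u v → x :* (:- u) :+ y :* (:- v) := :- (x :* u :+ y :* v)) refl

  ∼-sym : ∀ {m n} → m ∼ n → n ∼ m
  ∼-sym (plus m≈n)  = plus (≈M-sym m≈n)
  ∼-sym (minus m≈-n) = minus (≈M-trans (≈M-sym (neg-involutive _)) (neg-cong (≈M-sym m≈-n)))

  ∼-trans : ∀ {m n o} → m ∼ n → n ∼ o → m ∼ o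
  ∼-trans (plus p) (plus r) = plus (≈M-trans p r)
  ∼-trans (plus p) (minus r) = minus (≈M-trans p r)
  ∼-trans (minus p) (plus r) = minus (≈M-trans p (neg-cong r))
  ∼-trans (minus p) (minus r) = plus (≈M-trans p (≈M-trans (neg-cong r) (neg-involutive _)))

  neg-∼ : ∀ m → neg m ∼ m
  neg-∼ m = minus ≈M-refl

  PSL-setoid : Setoid 0ℓ 0ℓ
  PSL-setoid = record
    { Carrier = Mat F ; _≈_ = _∼_
    ; isEquivalence = record { refl = plus ≈M-refl ; sym = ∼-sym ; trans = ∼-trans } }

  open Setoid PSL-setoid public using () renaming (refl to ∼-refl)

  ∙-congˡ : ∀ {m n n′} → n ∼ n′ → m ∙ n ∼ m ∙ n′
  ∙-congˡ (plus p) = plus (∙-cong ≈M-refl p)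
  ∙-congˡ (minus p) = minus (≈M-trans (∙-cong ≈M-refl p) (neg-∙ʳ _ _))

  ∙-congʳ : ∀ {m m′ n} → m ∼ m′ → m ∙ n ∼ m′ ∙ n
  ∙-congʳ (plus p) = plus (∙-cong p ≈M-refl)
  ∙-congʳ (minus p) = minus (≈M-trans (∙-cong p ≈M-refl) (neg-∙ˡ _ _))

  opaque
    unfolding _∙_ adj neg T

    adj-cong : ∀ {m n} → m ∼ n → adj m ∼ adj n
    adj-cong (plus  (entries (α , β , γ , δ))) = plus (entries (δ , -‿cong β , -‿cong γ , α))
    adj-cong (minus (entries (α , β , γ , δ))) = minus (entries (δ , -‿cong β , -‿cong γ , α))

    adj-∙ : ∀ m n → adj (m ∙ n) ≈M adj n ∙ adj m
    adj-∙ (mat a b c d) (mat a′ b′ c′ d′) = entries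
      (solve 4 (λ c d b′ d′ → c :* b′ :+ d :* d′ := d′ :* d :+ (:- b′) :* (:- c)) refl c d b′ d′ ,
      solve 4 (λ a b b′ d′ → :- (a :* b′ :+ b :* d′) := d′ :* (:- b) :+ (:- b′) :* a) refl a b b′ d′ ,
      solve 4 (λ c d a′ c′ → :- (c :* a′ :+ d :* c′) := (:- c′) :* d :+ a′ :* (:- c)) refl c d a′ c′ ,
      solve 4 (λ a b a′ c′ → a :* a′ :+ b :* c′ := (:- c′) :* (:- b) :+ a′ :* a) refl a b a′ c′)

  adj-cancelˡ : ∀ {m} n → SL m → adj m ∙ (m ∙ n) ≈M n
  adj-cancelˡ {m} n sm = ≈M-trans (≈M-sym (∙-assoc (adj m) m n))
    (≈M-trans (∙-cong (adj-inverseˡ sm) ≈M-refl) (∙-identityˡ n))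

  cancel-adjˡ : ∀ {m} n → SL m → m ∙ (adj m ∙ n) ≈M n
  cancel-adjˡ {m} n sm = ≈M-trans (≈M-sym (∙-assoc m (adj m) n))
    (≈M-trans (∙-cong (adj-inverseʳ sm) ≈M-refl) (∙-identityˡ n))

  adj-cancelʳ : ∀ {m} n → SL m → (n ∙ adj m) ∙ m ≈M n
  adj-cancelʳ {m} n sm = ≈M-trans (∙-assoc n (adj m) m)
    (≈M-trans (∙-cong ≈M-refl (adj-inverseˡ sm)) (∙-identityʳ n))

  cancel-adjʳ : ∀ {m} n → SL m → (n ∙ m) ∙ adj m ≈M n
  cancel-adjʳ {m} n sm = ≈M-trans (∙-assoc n m (adj m))
    (≈M-trans (∙-cong ≈M-refl (adj-inverseʳ sm)) (∙-identityʳ n))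

  ∙-cancelˡ : ∀ {m n n′} → SL m → m ∙ n ∼ m ∙ n′ → n ∼ n′
  ∙-cancelˡ {m} {n} {n′} sm eq = begin
    n                  ≈⟨ plus (adj-cancelˡ n sm) ⟨
    adj m ∙ (m ∙ n)    ≈⟨ ∙-congˡ eq ⟩
    adj m ∙ (m ∙ n′)   ≈⟨ plus (adj-cancelˡ n′ sm) ⟩
    n′                 ∎
    where open import Relation.Binary.Reasoning.Setoid PSL-setoid

  ∙-cancelʳ : ∀ {m n n′} → SL m → n ∙ m ∼ n′ ∙ m → n ∼ n′
  ∙-cancelʳ {m} {n} {n′} sm eq = begin
    n                  ≈⟨ plus (cancel-adjʳ n sm) ⟨
    (n ∙ m) ∙ adj m    ≈⟨ ∙-congʳ eq ⟩
    (n′ ∙ m) ∙ adj m   ≈⟨ plus (cancel-adjʳ n′ sm) ⟩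
    n′                 ∎
    where open import Relation.Binary.Reasoning.Setoid PSL-setoid

  conj : Mat F → Mat F → Mat F
  conj x k = (x ∙ k) ∙ adj x

  opaque
    unfolding _∙_ adj neg T

    T-cong : ∀ {e e′ p p′ s s′} → e ≈ e′ → p ≈ p′ → s ≈ s′ → T e p s ≈M T e′ p′ s′
    T-cong e≈ p≈ s≈ = entries (+-congˡ (-‿cong (*-cong e≈ (*-cong p≈ s≈))) , *-cong e≈ (*-cong p≈ p≈) ,
                      -‿cong (*-cong e≈ (*-cong s≈ s≈)) , +-congˡ (*-cong e≈ (*-cong p≈ s≈)))

    T-SL : ∀ e p s → SL (T e p s)
    T-SL = solve 3 (λ e p s → (con 𝟙 :- e :* (p :* s)) :* (con 𝟙 :+ e :* (p :* s)) :-
      (e :* (p :* p)) :* (:- (e :* (s :* s))) := con 𝟙) refl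

    T-rescale : ∀ e r p s → T e (r * p) (r * s) ≈M T (e * (r * r)) p s
    T-rescale e r p s = entries
      (solve 4 (λ e r p s → con 𝟙 :- e :* ((r :* p) :* (r :* s)) := con 𝟙 :- (e :* (r :* r)) :* (p :* s)) refl e r p s ,
      solve 3 (λ e r p → e :* ((r :* p) :* (r :* p)) := (e :* (r :* r)) :* (p :* p)) refl e r p ,
      solve 3 (λ e r s → :- (e :* ((r :* s) :* (r :* s))) := :- ((e :* (r :* r)) :* (s :* s))) refl e r s ,
      solve 4 (λ e r p s → con 𝟙 :+ e :* ((r :* p) :* (r :* s)) := con 𝟙 :+ (e :* (r :* r)) :* (p :* s)) refl e r p s)

    T-zero : ∀ e → T e 0# 0# ≈M I
    T-zero e = entries
      (solve 1 (λ e → con 𝟙 :- e :* (con 𝟘 :* con 𝟘) := con 𝟙) refl e ,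
      solve 1 (λ e → e :* (con 𝟘 :* con 𝟘) := con 𝟘) refl e ,
      solve 1 (λ e → :- (e :* (con 𝟘 :* con 𝟘)) := con 𝟘) refl e ,
      solve 1 (λ e → con 𝟙 :+ e :* (con 𝟘 :* con 𝟘) := con 𝟙) refl e)

    adj-T : ∀ e p s → adj (T e p s) ≈M T (- e) p s
    adj-T e p s = entries
      (solve 2 (λ e x → con 𝟙 :+ e :* x := con 𝟙 :- (:- e) :* x) refl e (p * s) ,
      solve 2 (λ e x → :- (e :* x) := (:- e) :* x) refl e (p * p) ,
      solve 2 (λ e x → :- (:- (e :* x)) := :- ((:- e) :* x)) refl e (s * s) ,
      solve 2 (λ e x → con 𝟙 :- e :* x := con 𝟙 :+ (:- e) :* x) refl e (p * s))

    -- The cross term contains vᵀ J v = 0, so transvections with a fixed vector multiply by adding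
    -- scalars.
    T-∙ : ∀ e e′ p s → T e p s ∙ T e′ p s ≈M T (e + e′) p s
    T-∙ e e′ p s = entries
      (solve 4 (λ e f p s → (con 𝟙 :- e :* (p :* s)) :* (con 𝟙 :- f :* (p :* s)) :+ (e :* (p :* p)) :* (:- (f :* (s :* s)))
        := con 𝟙 :- (e :+ f) :* (p :* s)) refl e e′ p s ,
      solve 4 (λ e f p s → (con 𝟙 :- e :* (p :* s)) :* (f :* (p :* p)) :+ (e :* (p :* p)) :* (con 𝟙 :+ f :* (p :* s))
        := (e :+ f) :* (p :* p)) refl e e′ p s ,
      solve 4 (λ e f p s → (:- (e :* (s :* s))) :* (con 𝟙 :- f :* (p :* s)) :+ (con 𝟙 :+ e :* (p :* s)) :* (:- (f :* (s :* s)))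
        := :- ((e :+ f) :* (s :* s))) refl e e′ p s ,
      solve 4 (λ e f p s → (:- (e :* (s :* s))) :* (f :* (p :* p)) :+ (con 𝟙 :+ e :* (p :* s)) :* (con 𝟙 :+ f :* (p :* s))
        := con 𝟙 :+ (e :+ f) :* (p :* s)) refl e e′ p s)

    -- For determinant 1, J x⁻¹ = xᵀ J, so x (v vᵀ J) x⁻¹ = (x v)(x v)ᵀ J. Expanded, the diagonal
    -- entries match only up to det x - 1, which `mod-det` removes.
    conj-T : ∀ {x} e p s → SL x → conj x (T e p s) ≈M T e (a x * p + b x * s) (c x * p + d x * s)
    conj-T {mat a b c d} e p s sx = entries
      (mod-det (solve 7 (λ a b c d e p s →
        (a :* (con 𝟙 :- e :* (p :* s)) :+ b :* (:- (e :* (s :* s)))) :* d :+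
        (a :* (e :* (p :* p)) :+ b :* (con 𝟙 :+ e :* (p :* s))) :* (:- c)
        := (con 𝟙 :- e :* ((a :* p :+ b :* s) :* (c :* p :+ d :* s))) :+ (a :* d :- b :* c :- con 𝟙)) refl a b c d e p s) ,
      solve 5 (λ a b e p s →
        (a :* (con 𝟙 :- e :* (p :* s)) :+ b :* (:- (e :* (s :* s)))) :* (:- b) :+
        (a :* (e :* (p :* p)) :+ b :* (con 𝟙 :+ e :* (p :* s))) :* a
        := e :* ((a :* p :+ b :* s) :* (a :* p :+ b :* s))) refl a b e p s ,
      solve 5 (λ c d e p s →
        (c :* (con 𝟙 :- e :* (p :* s)) :+ d :* (:- (e :* (s :* s)))) :* d :+
        (c :* (e :* (p :* p)) :+ d :* (con 𝟙 :+ e :* (p :* s))) :* (:- c)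
        := :- (e :* ((c :* p :+ d :* s) :* (c :* p :+ d :* s)))) refl c d e p s ,
      mod-det (solve 7 (λ a b c d e p s →
        (c :* (con 𝟙 :- e :* (p :* s)) :+ d :* (:- (e :* (s :* s)))) :* (:- b) :+
        (c :* (e :* (p :* p)) :+ d :* (con 𝟙 :+ e :* (p :* s))) :* a
        := (con 𝟙 :+ e :* ((a :* p :+ b :* s) :* (c :* p :+ d :* s))) :+ (a :* d :- b :* c :- con 𝟙)) refl a b c d e p s))
      where
      mod-det : ∀ {u v} → u ≈ v + (a * d - b * c - 1#) → u ≈ v
      mod-det eq = trans eq (trans (+-congˡ (x≈y⇒x-y≈0 sx)) (+-identityʳ _))

  -- The symplectic form vᵀ J w, zero exactly on dependent pairs.
  ω : Carrier → Carrier → Carrier → Carrier → Carrier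
  ω p s p′ s′ = p * s′ - s * p′

  opaque
    unfolding _∙_ adj neg T

    -- Each nilpotent part v vᵀ J has trace 0, so only the identity and the product of the two parts
    -- contribute; the -1 is the trace 2 of the identity.
    tr-adj-T-∙-T : ∀ e p s e′ p′ s′ →
      tr (adj (T e p s) ∙ T e′ p′ s′) ≈ - 1# + (e * e′) * (ω p s p′ s′ * ω p s p′ s′)
    tr-adj-T-∙-T = solve 6 (λ e p s f u v →
      ((con 𝟙 :+ e :* (p :* s)) :* (con 𝟙 :- f :* (u :* v)) :+ (:- (e :* (p :* p))) :* (:- (f :* (v :* v)))) :+
      ((:- (:- (e :* (s :* s)))) :* (f :* (u :* u)) :+ (con 𝟙 :- e :* (p :* s)) :* (con 𝟙 :+ f :* (u :* v)))
      := (:- con 𝟙) :+ (e :* f) :* ((p :* v :- s :* u) :* (p :* v :- s :* u))) refl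

    tr-T : ∀ e p s → tr (T e p s) ≈ - 1#
    tr-T = solve 3 (λ e p s → (con 𝟙 :- e :* (p :* s)) :+ (con 𝟙 :+ e :* (p :* s)) := :- con 𝟙) refl

    tr-neg : ∀ m → tr (neg m) ≈ - tr m
    tr-neg m = solve 2 (λ x y → (:- x) :+ (:- y) := :- (x :+ y)) refl (a m) (d m)

  tr-cong : ∀ {m n} → m ≈M n → tr m ≈ tr n
  tr-cong (entries (α , _ , _ , δ)) = +-cong α δ

  tr-∼ : ∀ {m n} → m ∼ n → tr m ≈ tr n ⊎ tr m ≈ - tr n
  tr-∼ (plus  eq) = inj₁ (tr-cong eq)
  tr-∼ (minus eq) = inj₂ (trans (tr-cong eq) (tr-neg _))

  -- The trace fixes the sign: transvections have trace -1, their negatives trace 1, and these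
  -- differ in characteristic 3.
  T-∼⇒≈M : ∀ {e p s e′ p′ s′} → T e p s ∼ T e′ p′ s′ → T e p s ≈M T e′ p′ s′
  T-∼⇒≈M (plus eq) = eq
  T-∼⇒≈M {e} {p} {s} {e′} {p′} {s′} (minus eq) = contradiction (x≈-x⇒x≈0 (begin
    - 1#                      ≈⟨ tr-T e p s ⟨
    tr (T e p s)              ≈⟨ tr-cong eq ⟩
    tr (neg (T e′ p′ s′))     ≈⟨ tr-neg _ ⟩
    - tr (T e′ p′ s′)         ≈⟨ -‿cong (tr-T e′ p′ s′) ⟩
    - - 1#                    ∎)) (λ -1≈0 → nontrivial (trans (sym (-‿involutive 1#)) (trans (-‿cong -1≈0) -0#≈0#)))
    where open import Relation.Binary.Reasoning.Setoid setoid

  opaque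
    unfolding _∙_ adj neg T

    ∼⇒~ : ∀ {m n} → m ∼ n → Defs._~_ F m n
    ∼⇒~ (plus  (entries eq)) = inj₁ eq
    ∼⇒~ (minus (entries eq)) = inj₂ eq

    ~⇒∼ : ∀ {m n} → Defs._~_ F m n → m ∼ n
    ~⇒∼ (inj₁ eq) = plus (entries eq)
    ~⇒∼ (inj₂ eq) = minus (entries eq)

-- Elements and subgroups of order 3

module OrderThree {q : ℕ} (F : FiniteField q)
  (1+1+1≈0 : HasCharacteristic3 F) where
  open SpecialLinear F 1+1+1≈0 public
  open Solver

  2≈-1 : ∀ {x} → x + x ≈ - x
  2≈-1 {x} = solve 1 (λ x → x :+ x := :- x) refl x

  IsTransvection : Mat F → Set
  IsTransvection m = ∃ λ e → ∃ λ p → ∃ λ s → ¬ e ≈ 0# × ¬ (p ≈ 0# × s ≈ 0#) × m ∼ T e p s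

  opaque
    unfolding _∙_ adj neg T

    -- The witnesses are read off the entries of `T e p s`. If the upper right entry y is nonzero,
    -- take e = y and v = (1 , s), where x = 1 - y s determines s; trace and determinant then give
    -- the lower row. If y = 0, they force both diagonal entries to be 1, so v = (0 , 1) and e = -z.
    tr≈-1⇒transvection : ∀ {m} → SL m → tr m ≈ - 1# → ¬ m ∼ I → IsTransvection m
    tr≈-1⇒transvection {mat x y z w} sm tr≈-1 m≁I with y ≟ 0#
    ... | no y≉0 with inverse y y≉0
    ...   | y⁻¹ , yy⁻¹≈1 = y , 1# , s , y≉0 , (λ { (1≈0 , _) → nontrivial 1≈0 }) , plus (entries
      ( sym (trans (+-congˡ (-‿cong ys)) (solve 1 (λ x → con 𝟙 :- (con 𝟙 :- x) := x) refl x))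
      , solve 1 (λ y → y := y :* (con 𝟙 :* con 𝟙)) refl y
      , sym (x-y≈0⇒x≈y (xy≈0⇒y≈0 y≉0 zy))
      , sym (trans (+-congˡ ys) (trans (solve 2 (λ x w → con 𝟙 :+ (con 𝟙 :- x) := w :- (x :+ w :+ con 𝟙)) refl x w)
          (trans (+-congˡ (-‿cong tr+1)) (solve 1 (λ w → w :- con 𝟘 := w) refl w))))
      ))
      where
      open SetoidReasoning setoid
      s : Carrier
      s = (1# - x) * y⁻¹
      tr+1 : x + w + 1# ≈ 0#
      tr+1 = trans (+-congʳ tr≈-1) (-‿inverseˡ 1#)
      ys : y * (1# * s) ≈ 1# - x
      ys = trans (solve 3 (λ x y v → y :* (con 𝟙 :* ((con 𝟙 :- x) :* v)) := (con 𝟙 :- x) :* (y :* v)) refl x y y⁻¹)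
        (trans (*-congˡ yy⁻¹≈1) (*-identityʳ _))
      zy : y * (- (y * (s * s)) - z) ≈ 0#
      zy = begin
        y * (- (y * (s * s)) - z)
          ≈⟨ solve 5 (λ x y z w s → y :* (:- (y :* (s :* s)) :- z) :=
               (x :* w :- y :* z) :- (x :* (x :+ w :+ con 𝟙) :- x :* x :- x)
               :- (y :* (con 𝟙 :* s)) :* (y :* (con 𝟙 :* s))) refl x y z w s ⟩
        (x * w - y * z) - (x * (x + w + 1#) - x * x - x) - (y * (1# * s)) * (y * (1# * s))
          ≈⟨ +-cong (+-cong sm (-‿cong (+-congʳ (+-congʳ (*-congˡ tr+1))))) (-‿cong (*-cong ys ys)) ⟩
        1# - (x * 0# - x * x - x) - (1# - x) * (1# - x)
          ≈⟨ solve 1 (λ x → con 𝟙 :- (x :* con 𝟘 :- x :* x :- x) :- (con 𝟙 :- x) :* (con 𝟙 :- x) := con 𝟘) refl x ⟩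
        0# ∎
    tr≈-1⇒transvection {mat x y z w} sm tr≈-1 m≁I | yes y≈0 =
      - z , 0# , 1# , (λ -z≈0 → m≁I (plus (entries (x≈1 , y≈0 , trans (sym (-‿involutive z)) (trans (-‿cong -z≈0) -0#≈0#) , w≈1))))
      , (λ { (_ , 1≈0) → nontrivial 1≈0 }) , plus (entries
      ( trans x≈1 (solve 1 (λ z → con 𝟙 := con 𝟙 :- (:- z) :* (con 𝟘 :* con 𝟙)) refl z)
      , trans y≈0 (solve 1 (λ z → con 𝟘 := (:- z) :* (con 𝟘 :* con 𝟘)) refl z)
      , solve 1 (λ z → z := :- ((:- z) :* (con 𝟙 :* con 𝟙))) refl z
      , trans w≈1 (solve 1 (λ z → con 𝟙 := con 𝟙 :+ (:- z) :* (con 𝟘 :* con 𝟙)) refl z) ))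
      where
      open SetoidReasoning setoid
      tr+1 : x + w + 1# ≈ 0#
      tr+1 = trans (+-congʳ tr≈-1) (-‿inverseˡ 1#)
      x≈1 : x ≈ 1#
      x≈1 = x-y≈0⇒x≈y (x²≈0⇒x≈0 (begin
        (x - 1#) * (x - 1#)
          ≈⟨ solve 4 (λ x y z w → (x :- con 𝟙) :* (x :- con 𝟙) :=
               con 𝟙 :- (x :* w :- y :* z) :- y :* z :+ x :* (x :+ w :+ con 𝟙)) refl x y z w ⟩
        1# - (x * w - y * z) - y * z + x * (x + w + 1#)
          ≈⟨ +-cong (+-cong (+-congˡ (-‿cong sm)) (-‿cong (*-congʳ y≈0))) (*-congˡ tr+1) ⟩
        1# - 1# - 0# * z + x * 0#
          ≈⟨ solve 2 (λ x z → con 𝟙 :- con 𝟙 :- con 𝟘 :* z :+ x :* con 𝟘 := con 𝟘) refl x z ⟩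
        0# ∎))
      w≈1 : w ≈ 1#
      w≈1 = begin
        w                        ≈⟨ solve 2 (λ x w → w := (x :+ w :+ con 𝟙) :- x :- con 𝟙) refl x w ⟩
        (x + w + 1#) - x - 1#    ≈⟨ +-congʳ (+-cong tr+1 (-‿cong x≈1)) ⟩
        0# - 1# - 1#             ≈⟨ solve 0 (con 𝟘 :- con 𝟙 :- con 𝟙 := con 𝟙) refl ⟩
        1#                       ∎

    scalar⇒∼I : ∀ {m} → SL m → b m ≈ 0# → c m ≈ 0# → a m ≈ d m → m ∼ I
    scalar⇒∼I {mat x y z w} sm y≈0 z≈0 x≈w with x²≈1⇒x≈±1 {x} (trans (*-congˡ x≈w) (trans
      (solve 3 (λ x w y → x :* w := x :* w :- con 𝟘 :* y) refl x w z) (trans (+-congˡ (-‿cong (*-congʳ (sym y≈0)))) sm)))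
    ... | inj₁ x≈1  = plus (entries (x≈1 , y≈0 , z≈0 , trans (sym x≈w) x≈1))
    ... | inj₂ x≈-1 = minus (entries (x≈-1 , trans y≈0 (sym -0#≈0#) , trans z≈0 (sym -0#≈0#) , trans (sym x≈w) x≈-1))

    ∼I⇒scalar : ∀ {m} → m ∼ I → b m ≈ 0# × c m ≈ 0# × a m ≈ d m
    ∼I⇒scalar (plus  (entries (α , β , γ , δ))) = β , γ , trans α (sym δ)
    ∼I⇒scalar (minus (entries (α , β , γ , δ))) = trans β -0#≈0# , trans γ -0#≈0# , trans α (sym δ)

    -- By Cayley–Hamilton, m³ = (t² − 1) m − t I with t = tr m.
    cube∼I⇒tr²≈1 : ∀ {m} → SL m → ¬ m ∼ I → m ∙ (m ∙ m) ∼ I → tr m * tr m ≈ 1#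
    cube∼I⇒tr²≈1 {m@(mat x y z w)} sm m≁I m³∼I with tr m * tr m - det m ≟ 0#
    ... | yes u≈0 = trans (x-y≈0⇒x≈y u≈0) sm
    ... | no  u≉0 with ∼I⇒scalar m³∼I
    ...   | β , γ , α≈δ = contradiction (scalar⇒∼I sm
      (xy≈0⇒y≈0 u≉0 (trans (solve 4 (λ x y z w →
        ((x :+ w) :* (x :+ w) :- (x :* w :- y :* z)) :* y :=
        x :* (x :* y :+ y :* w) :+ y :* (z :* y :+ w :* w)) refl x y z w) β))
      (xy≈0⇒y≈0 u≉0 (trans (solve 4 (λ x y z w →
        ((x :+ w) :* (x :+ w) :- (x :* w :- y :* z)) :* z :=
        z :* (x :* x :+ y :* z) :+ w :* (z :* x :+ w :* z)) refl x y z w) γ))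
      (x-y≈0⇒x≈y (xy≈0⇒y≈0 u≉0 (trans (solve 4 (λ x y z w →
        ((x :+ w) :* (x :+ w) :- (x :* w :- y :* z)) :* (x :- w) :=
        (x :* (x :* x :+ y :* z) :+ y :* (z :* x :+ w :* z)) :- (z :* (x :* y :+ y :* w) :+ w :* (z :* y :+ w :* w)))
        refl x y z w) (x≈y⇒x-y≈0 α≈δ))))) m≁I

  -- Trace 1 reduces to trace -1 by passing to -m, the same element of PSL.
  cube∼I⇒transvection : ∀ {m} → SL m → ¬ m ∼ I → m ∙ (m ∙ m) ∼ I → IsTransvection m
  cube∼I⇒transvection {m} sm m≁I m³∼I with x²≈1⇒x≈±1 (cube∼I⇒tr²≈1 sm m≁I m³∼I)
  ... | inj₂ tr≈-1 = tr≈-1⇒transvection sm tr≈-1 m≁I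
  ... | inj₁ tr≈1 with tr≈-1⇒transvection (SL-neg sm) (trans (tr-neg m) (-‿cong tr≈1))
      (λ n∼I → m≁I (∼-trans (∼-sym (neg-∼ m)) n∼I))
  ...   | e , p , s , e≉0 , v≉0 , eq = e , p , s , e≉0 , v≉0 , ∼-trans (∼-sym (neg-∼ m)) eq

  record IsSubgroup (H : Mat F → Set) : Set where
    field
      H-SL   : ∀ {m} → H m → SL m
      H-resp : ∀ {m n} → m ∼ n → H m → H n
      H-I    : H I
      H-∙    : ∀ {m n} → H m → H n → H (m ∙ n)
      H-adj  : ∀ {m} → H m → H (adj m)

  module _ {H : Mat F → Set} (isSubgroup : IsSubgroup H) where
    open IsSubgroup isSubgroup

    -- Closure leaves three candidates for each of m n and m m; cancellation excludes two of them,
    -- leaving m n = I and m m = n.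
    three⇒cyclic : ∀ {m n} → H m → H n → ¬ m ∼ I → ¬ n ∼ I → ¬ m ∼ n →
      (∀ k → H k → k ∼ I ⊎ k ∼ m ⊎ k ∼ n) →
      ∃ λ m → H m × ¬ m ∼ I × m ∙ (m ∙ m) ∼ I × (∀ k → H k → k ∼ I ⊎ k ∼ m ⊎ k ∼ m ∙ m)
    three⇒cyclic {m} {n} hm hn m≁I n≁I m≁n cover =
      m , hm , m≁I , ∼-trans (∙-congˡ m²∼n) mn∼I ,
      λ k hk → Sum.map₂ (Sum.map₂ (λ k∼n → ∼-trans k∼n (∼-sym m²∼n))) (cover k hk)
      where
      sm = H-SL hm
      sn = H-SL hn
      mn∼I : m ∙ n ∼ I
      mn∼I with cover (m ∙ n) (H-∙ hm hn)
      ... | inj₁ e        = e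
      ... | inj₂ (inj₁ e) = contradiction (∙-cancelˡ sm (∼-trans e (plus (≈M-sym (∙-identityʳ m))))) n≁I
      ... | inj₂ (inj₂ e) = contradiction (∙-cancelʳ sn (∼-trans e (plus (≈M-sym (∙-identityˡ n))))) m≁I
      m²∼n : m ∙ m ∼ n
      m²∼n with cover (m ∙ m) (H-∙ hm hm)
      ... | inj₁ e        = contradiction (∙-cancelˡ sm (∼-trans e (∼-sym mn∼I))) m≁n
      ... | inj₂ (inj₁ e) = contradiction (∙-cancelˡ sm (∼-trans e (plus (≈M-sym (∙-identityʳ m))))) m≁I
      ... | inj₂ (inj₂ e) = e

    order-3⇒cyclic : IsCard _∼_ H 3 →
      ∃ λ m → H m × ¬ m ∼ I × m ∙ (m ∙ m) ∼ I × (∀ k → H k → k ∼ I ⊎ k ∼ m ⊎ k ∼ m ∙ m)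
    order-3⇒cyclic (x ∷ y ∷ z ∷ [] , ≡.refl , hx ∷ hy ∷ hz ∷ [] , (x≁y ∷ x≁z ∷ []) ∷ (y≁z ∷ []) ∷ _ , cover)
      with cover I H-I
    ... | here I∼x = three⇒cyclic hy hz (≁I (x≁y ∘ ∼-sym)) (≁I (x≁z ∘ ∼-sym)) y≁z
      (λ k hk → case cover k hk of λ
        { (here e) → inj₁ (∼-trans e (∼-sym I∼x))
        ; (there (here e)) → inj₂ (inj₁ e)
        ; (there (there (here e))) → inj₂ (inj₂ e) })
      where
      ≁I : ∀ {w} → ¬ w ∼ x → ¬ w ∼ I
      ≁I w≁x w∼I = w≁x (∼-trans w∼I I∼x)
    ... | there (here I∼y) = three⇒cyclic hx hz (≁I x≁y) (≁I (y≁z ∘ ∼-sym)) x≁z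
      (λ k hk → case cover k hk of λ
        { (here e) → inj₂ (inj₁ e)
        ; (there (here e)) → inj₁ (∼-trans e (∼-sym I∼y))
        ; (there (there (here e))) → inj₂ (inj₂ e) })
      where
      ≁I : ∀ {w} → ¬ w ∼ y → ¬ w ∼ I
      ≁I w≁y w∼I = w≁y (∼-trans w∼I I∼y)
    ... | there (there (here I∼z)) = three⇒cyclic hx hy (≁I x≁z) (≁I y≁z) x≁y
      (λ k hk → case cover k hk of λ
        { (here e) → inj₂ (inj₁ e)
        ; (there (here e)) → inj₂ (inj₂ e)
        ; (there (there (here e))) → inj₁ (∼-trans e (∼-sym I∼z)) })
      where
      ≁I : ∀ {w} → ¬ w ∼ z → ¬ w ∼ I
      ≁I w≁z w∼I = w≁z (∼-trans w∼I I∼z)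

    order-3⇒transvections : IsCard _∼_ H 3 → ∃ λ e → ∃ λ p → ∃ λ s →
      ¬ e ≈ 0# × ¬ (p ≈ 0# × s ≈ 0#) × H (T e p s) × H (T (- e) p s) ×
      (∀ k → H k → k ∼ I ⊎ k ∼ T e p s ⊎ k ∼ T (- e) p s)
    order-3⇒transvections card with order-3⇒cyclic card
    ... | m , hm , m≁I , m³∼I , cover with cube∼I⇒transvection (H-SL hm) m≁I m³∼I
    ...   | e , p , s , e≉0 , v≉0 , m∼T = e , p , s , e≉0 , v≉0 , H-resp m∼T hm , H-resp m²∼T (H-∙ hm hm) ,
      λ k hk → Sum.map₂ (Sum.map (λ k∼m → ∼-trans k∼m m∼T) (λ k∼m² → ∼-trans k∼m² m²∼T)) (cover k hk)
      where
      m²∼T : m ∙ m ∼ T (- e) p s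
      m²∼T = begin
        m ∙ m                ≈⟨ ∼-trans (∙-congˡ m∼T) (∙-congʳ m∼T) ⟩
        T e p s ∙ T e p s    ≈⟨ plus (T-∙ e e p s) ⟩
        T (e + e) p s        ≈⟨ plus (T-cong 2≈-1 refl refl) ⟩
        T (- e) p s          ∎
        where open SetoidReasoning PSL-setoid

  complete-to-SL : ∀ {p s} → ¬ (p ≈ 0# × s ≈ 0#) → ∃ λ u → ∃ λ v → SL (mat p u s v)
  complete-to-SL {p} {s} v≉0 with p ≟ 0# | s ≟ 0#
  ... | yes p≈0 | yes s≈0 = contradiction (p≈0 , s≈0) v≉0
  ... | no p≉0  | _ with inverse p p≉0
  ...   | p⁻¹ , eq = 0# , p⁻¹ , trans (solve 3 (λ p s i → p :* i :- con 𝟘 :* s := p :* i) refl p s p⁻¹) eq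
  complete-to-SL {p} {s} v≉0 | yes p≈0 | no s≉0 with inverse s s≉0
  ...   | s⁻¹ , eq = - s⁻¹ , 0# , trans (solve 3 (λ p s i → p :* con 𝟘 :- (:- i) :* s := s :* i) refl p s s⁻¹) eq

  opaque
    unfolding _∙_ adj neg T

    -- Complete both vectors to first columns of matrices M and M′ of determinant 1; then M′ M⁻¹
    -- moves one to the other.
    SL-transitive : ∀ {p s p′ s′} → ¬ (p ≈ 0# × s ≈ 0#) → ¬ (p′ ≈ 0# × s′ ≈ 0#) →
      ∃ λ x → SL x × a x * p + b x * s ≈ p′ × c x * p + d x * s ≈ s′
    SL-transitive {p} {s} {p′} {s′} v≉0 v′≉0 with complete-to-SL v≉0 | complete-to-SL v′≉0
    ... | u , v , sm | u′ , v′ , sm′ = mat p′ u′ s′ v′ ∙ adj (mat p u s v) , SL-∙ sm′ (SL-adj sm) ,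
      entry p′ u′ , entry s′ v′
      where
      entry : ∀ x y → (x * v + y * - s) * p + (x * - u + y * p) * s ≈ x
      entry x y = trans (solve 6 (λ p u s v x y → (x :* v :+ y :* (:- s)) :* p :+ (x :* (:- u) :+ y :* p) :* s
        := x :* (p :* v :- u :* s)) refl p u s v x y) (trans (*-congˡ sm) (*-identityʳ x))

  -- Agreement on a coset and point stabilizers

  module TransvectionSubgroup {H : Mat F → Set} (isSubgroup : IsSubgroup H) (card-H : IsCard _∼_ H 3)
    (e₀ p₀ s₀ : Carrier) (v₀≉0 : ¬ (p₀ ≈ 0# × s₀ ≈ 0#)) (h₊ : H (T e₀ p₀ s₀)) (h₋ : H (T (- e₀) p₀ s₀))
    (cover : ∀ k → H k → k ∼ I ⊎ k ∼ T e₀ p₀ s₀ ⊎ k ∼ T (- e₀) p₀ s₀) where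

    open IsSubgroup isSubgroup

    Admissible : Carrier → Set
    Admissible e = e ≈ e₀ ⊎ e ≈ - e₀

    Agree : Mat F → Mat F → Set
    Agree g h = ∃ λ x → SL x × ∃ λ k → H k × h ∙ x ∼ (g ∙ x) ∙ k

    Stabilizes : Mat F → Mat F → Set
    Stabilizes x g = SL g × ∃ λ k → H k × x ∼ (g ∙ x) ∙ k

    -- The vector may be zero, so that equal elements are linked too.
    Linked : Mat F → Mat F → Set
    Linked g h = ∃ λ e → ∃ λ p → ∃ λ s → Admissible e × adj g ∙ h ∼ T e p s

    conj-cong : ∀ x {k k′} → k ∼ k′ → conj x k ∼ conj x k′
    conj-cong x k∼k′ = ∙-congʳ (∙-congˡ k∼k′)

    conj-H : ∀ {x k} → SL x → H k → ∃ λ e → ∃ λ p → ∃ λ s → Admissible e × conj x k ∼ T e p s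
    conj-H {x} {k} sx hk with cover k hk
    ... | inj₁ k∼I = e₀ , 0# , 0# , inj₁ refl , (begin
      conj x k          ≈⟨ conj-cong x k∼I ⟩
      conj x I          ≈⟨ ∙-congʳ (plus (∙-identityʳ x)) ⟩
      x ∙ adj x         ≈⟨ plus (adj-inverseʳ sx) ⟩
      I                 ≈⟨ plus (T-zero e₀) ⟨
      T e₀ 0# 0#        ∎)
      where open SetoidReasoning PSL-setoid
    ... | inj₂ (inj₁ k∼T) = e₀ , a x * p₀ + b x * s₀ , c x * p₀ + d x * s₀ , inj₁ refl ,
      ∼-trans {conj x k} {conj x (T e₀ p₀ s₀)} (conj-cong x k∼T) (plus (conj-T e₀ p₀ s₀ sx))
    ... | inj₂ (inj₂ k∼T) = - e₀ , a x * p₀ + b x * s₀ , c x * p₀ + d x * s₀ , inj₂ refl ,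
      ∼-trans {conj x k} {conj x (T (- e₀) p₀ s₀)} (conj-cong x k∼T) (plus (conj-T (- e₀) p₀ s₀ sx))

    -- With `conj-H`, this identifies the union of the conjugates of H. A nonzero v is reached from
    -- v₀ by transitivity; v = 0 is the identity.
    H-conj : ∀ {e} p s → Admissible e → ∃ λ x → ∃ λ k → SL x × H k × conj x k ∼ T e p s
    H-conj {e} p s adm with p ≟ 0# ×-dec s ≟ 0#
    ... | yes (p≈0 , s≈0) = I , I , SL-I , H-I , (begin
      conj I I          ≈⟨ ∙-congʳ (plus (∙-identityʳ I)) ⟩
      I ∙ adj I         ≈⟨ plus (adj-inverseʳ SL-I) ⟩
      I                 ≈⟨ plus (T-zero e) ⟨
      T e 0# 0#         ≈⟨ plus (T-cong refl (sym p≈0) (sym s≈0)) ⟩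
      T e p s           ∎)
      where open SetoidReasoning PSL-setoid
    ... | no v≉0 with SL-transitive v₀≉0 v≉0
    ...   | x , sx , xp , xs = x , T e p₀ s₀ , sx , h adm , (begin
      conj x (T e p₀ s₀)                                   ≈⟨ plus (conj-T e p₀ s₀ sx) ⟩
      T e (a x * p₀ + b x * s₀) (c x * p₀ + d x * s₀)      ≈⟨ plus (T-cong refl xp xs) ⟩
      T e p s                                              ∎)
      where
      open SetoidReasoning PSL-setoid
      h : ∀ {e} → Admissible e → H (T e p₀ s₀)
      h (inj₁ e≈)  = H-resp (plus (T-cong (sym e≈) refl refl)) h₊
      h (inj₂ e≈-) = H-resp (plus (T-cong (sym e≈-) refl refl)) h₋

    -- h x = g x k is the same as g⁻¹ h = x k x⁻¹.
    agree⇒linked : ∀ {g h} → SL g → Agree g h → Linked g h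
    agree⇒linked {g} {h} sg (x , sx , k , hk , eq) with conj-H sx hk
    ... | e , p , s , adm , conj∼T = e , p , s , adm , (begin
      adj g ∙ h                            ≈⟨ ∙-congˡ (plus (cancel-adjʳ h sx)) ⟨
      adj g ∙ ((h ∙ x) ∙ adj x)            ≈⟨ ∙-congˡ (∙-congʳ eq) ⟩
      adj g ∙ (((g ∙ x) ∙ k) ∙ adj x)      ≈⟨ ∙-congˡ (plus
        (≈M-trans (∙-cong (∙-assoc g x k) ≈M-refl) (∙-assoc g (x ∙ k) (adj x)))) ⟩
      adj g ∙ (g ∙ conj x k)               ≈⟨ plus (adj-cancelˡ (conj x k) sg) ⟩
      conj x k                             ≈⟨ conj∼T ⟩
      T e p s                              ∎)
      where open SetoidReasoning PSL-setoid

    linked⇒agree : ∀ {g h} → SL g → Linked g h → Agree g h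
    linked⇒agree {g} {h} sg (e , p , s , adm , eq) with H-conj p s adm
    ... | x , k , sx , hk , conj∼T = x , sx , k , hk , (begin
      h ∙ x                        ≈⟨ ∙-congʳ (plus (cancel-adjˡ h sg)) ⟨
      (g ∙ (adj g ∙ h)) ∙ x        ≈⟨ ∙-congʳ (∙-congˡ (∼-trans eq (∼-sym conj∼T))) ⟩
      (g ∙ conj x k) ∙ x           ≈⟨ plus (∙-assoc g (conj x k) x) ⟩
      g ∙ (conj x k ∙ x)           ≈⟨ ∙-congˡ (plus (adj-cancelʳ (x ∙ k) sx)) ⟩
      g ∙ (x ∙ k)                  ≈⟨ plus (∙-assoc g x k) ⟨
      (g ∙ x) ∙ k                  ∎)
      where open SetoidReasoning PSL-setoid

    -- The stabilizer of xH is x H x⁻¹, so the list of H is conjugated entry by entry.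
    stabilizer-card : ∀ {x} → SL x → IsCard _∼_ (Stabilizes x) 3
    stabilizer-card {x} sx = let (hs , length≡3 , hs∈H , distinct , cover-H) = card-H in
      map (conj x) hs , ≡.trans (List.length-map (conj x) hs) length≡3 ,
      All.map⁺ (All.map stab hs∈H) ,
      AllPairs.map⁺ (AllPairs.map (λ k≁k′ eq → k≁k′ (∙-cancelˡ sx (∙-cancelʳ (SL-adj sx) eq))) distinct) ,
      -- The condition reads x = g x k, so g = x k⁻¹ x⁻¹ and it is k⁻¹ that must be found in the
      -- list.
      λ g (sg , k , hk , eq) → Any.map⁺ (Any.map (λ {k′} adjk∼k′ → begin
        g                              ≈⟨ plus (cancel-adjʳ g sx) ⟨
        (g ∙ x) ∙ adj x                ≈⟨ ∙-congʳ (plus (cancel-adjʳ (g ∙ x) (H-SL hk))) ⟨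
        (((g ∙ x) ∙ k) ∙ adj k) ∙ adj x ≈⟨ ∙-congʳ (∙-congʳ eq) ⟨
        conj x (adj k)                 ≈⟨ conj-cong x adjk∼k′ ⟩
        conj x k′                      ∎) (cover-H (adj k) (H-adj hk)))
      where
      open SetoidReasoning PSL-setoid
      stab : ∀ {k} → H k → Stabilizes x (conj x k)
      stab {k} hk = SL-∙ (SL-∙ sx (H-SL hk)) (SL-adj sx) , adj k , H-adj hk , (begin
        x                              ≈⟨ plus (cancel-adjʳ x (H-SL hk)) ⟨
        (x ∙ k) ∙ adj k                ≈⟨ ∙-congʳ (plus (adj-cancelʳ (x ∙ k) sx)) ⟨
        (conj x k ∙ x) ∙ adj k         ∎)

    stabilizer-card-max : ∀ {x k} → SL x → IsCard _∼_ (Stabilizes x) k → k ≤ 3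
    stabilizer-card-max sx (gs , length≡k , gs∈Stab , distinct , _) =
      let (hs , length≡3 , _ , _ , cover-Stab) = stabilizer-card sx in
      ≡.subst₂ _≤_ length≡k length≡3 (distinct-pigeonhole ∼-sym distinct _∼_
        (λ g∼y g′∼y → ∼-trans g∼y (∼-sym g′∼y)) (All.map (λ {g} → cover-Stab g) gs∈Stab))

-- Upper bounds for cliques

module Cliques {q : ℕ} (F : FiniteField q)
  (1+1+1≈0 : HasCharacteristic3 F) where
  open OrderThree F 1+1+1≈0 public
  open Solver

  *-cancelʳ-≉0 : ∀ {x y z} → ¬ z ≈ 0# → x * z ≈ y * z → x ≈ y
  *-cancelʳ-≉0 z≉0 eq = *-cancelˡ-≉0 z≉0 (trans (*-comm _ _) (trans eq (*-comm _ _)))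

  parallel : ∀ {p s p′ s′} → ¬ (p ≈ 0# × s ≈ 0#) → ω p s p′ s′ ≈ 0# → ∃ λ r → p′ ≈ r * p × s′ ≈ r * s
  parallel {p} {s} {p′} {s′} v≉0 ω≈0 with p ≟ 0# | s ≟ 0#
  ... | yes p≈0 | yes s≈0 = contradiction (p≈0 , s≈0) v≉0
  ... | no p≉0  | _ with inverse p p≉0
  ...   | i , pi≈1 = p′ * i , sym (trans (trans (*-assoc p′ i p) (*-congˡ (trans (*-comm i p) pi≈1))) (*-identityʳ p′)) ,
    (begin
      s′              ≈⟨ *-identityʳ s′ ⟨
      s′ * 1#         ≈⟨ *-congˡ pi≈1 ⟨
      s′ * (p * i)    ≈⟨ solve 3 (λ s′ p i → s′ :* (p :* i) := (p :* s′) :* i) refl s′ p i ⟩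
      (p * s′) * i    ≈⟨ *-congʳ (x-y≈0⇒x≈y ω≈0) ⟩
      (s * p′) * i    ≈⟨ solve 3 (λ s p′ i → (s :* p′) :* i := (p′ :* i) :* s) refl s p′ i ⟩
      (p′ * i) * s    ∎)
    where open SetoidReasoning setoid
  parallel {p} {s} {p′} {s′} v≉0 ω≈0 | yes p≈0 | no s≉0 with inverse s s≉0
  ... | i , si≈1 = s′ * i , (begin
      p′              ≈⟨ *-identityʳ p′ ⟨
      p′ * 1#         ≈⟨ *-congˡ si≈1 ⟨
      p′ * (s * i)    ≈⟨ solve 3 (λ p′ s i → p′ :* (s :* i) := (s :* p′) :* i) refl p′ s i ⟩
      (s * p′) * i    ≈⟨ *-congʳ (x-y≈0⇒x≈y ω≈0) ⟨
      (p * s′) * i    ≈⟨ solve 3 (λ p s′ i → (p :* s′) :* i := (s′ :* i) :* p) refl p s′ i ⟩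
      (s′ * i) * p    ∎) ,
    sym (trans (trans (*-assoc s′ i s) (*-congˡ (trans (*-comm i s) si≈1))) (*-identityʳ s′))
    where open SetoidReasoning setoid

  square-ratio : ∀ {e f x y} → ¬ x ≈ 0# → e * (x * x) ≈ f * (y * y) → ∃ λ r → e ≈ f * (r * r)
  square-ratio {e} {f} {x} {y} x≉0 eq with inverse x x≉0
  ... | i , xi≈1 = y * i , *-cancelʳ-≉0 (*-≉0 x≉0 x≉0) (begin
    e * (x * x)                           ≈⟨ eq ⟩
    f * (y * y)                           ≈⟨ *-identityʳ _ ⟨
    f * (y * y) * 1#                      ≈⟨ *-congˡ (trans (*-cong xi≈1 xi≈1) (*-identityˡ 1#)) ⟨
    f * (y * y) * ((x * i) * (x * i))     ≈⟨ solve 4 (λ f x y i →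
      f :* (y :* y) :* ((x :* i) :* (x :* i)) := f :* ((y :* i) :* (y :* i)) :* (x :* x)) refl f x y i ⟩
    f * ((y * i) * (y * i)) * (x * x)     ∎)
    where open SetoidReasoning setoid

  opaque
    unfolding T

    -- The off-diagonal entries are e p² and -e s², one of them nonzero, so a nontrivial
    -- transvection determines the square class of its scalar.
    T-∼⇒square : ∀ {e p s f p′ s′} → ¬ (p ≈ 0# × s ≈ 0#) → T e p s ∼ T f p′ s′ → ∃ λ r → e ≈ f * (r * r)
    T-∼⇒square {e} {p} {s} {f} {p′} {s′} v≉0 eq with T-∼⇒≈M eq | p ≟ 0# | s ≟ 0#
    ... | _                       | yes p≈0 | yes s≈0 = contradiction (p≈0 , s≈0) v≉0
    ... | entries (_ , β , _ , _) | no p≉0  | _       = square-ratio p≉0 β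
    ... | entries (_ , _ , γ , _) | yes _   | no s≉0  =
      square-ratio s≉0 (trans (sym (-‿involutive _)) (trans (-‿cong γ) (-‿involutive _)))

    T-∼⇒scale≈ : ∀ {e f} → T e 1# 0# ∼ T f 1# 0# → e ≈ f
    T-∼⇒scale≈ {e} {f} eq with T-∼⇒≈M eq
    ... | entries (_ , β , _ , _) = trans (solve 1 (λ e → e := e :* (con 𝟙 :* con 𝟙)) refl e)
      (trans β (solve 1 (λ e → e :* (con 𝟙 :* con 𝟙) := e) refl f))

  signs : List Carrier
  signs = 0# ∷ 1# ∷ - 1# ∷ []

  Allowed : List Carrier → Carrier → Set
  Allowed Es e = Any (e ≈_) Es

  -- An intersecting set divided by one of its members, in coordinates. The list `Es` is e₀ , -e₀
  -- for odd n and e₀ alone for even n, so that both parities share the bounds.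
  record Clique (Es : List Carrier) (ℓ : ℕ) : Set where
    field
      E P S     : Fin ℓ → Carrier
      E-allowed : ∀ i → Allowed Es (E i)
      injective : ∀ {i j} → T (E i) (P i) (S i) ∼ T (E j) (P j) (S j) → i ≡ j
      linked    : ∀ i j → ∃ λ e → ∃ λ p → ∃ λ s →
                  Allowed Es e × adj (T (E i) (P i) (S i)) ∙ T (E j) (P j) (S j) ∼ T e p s

  -- For nonzero scalars this says that different members of `Es` lie in different square classes: r
  -- = ± 1 forces e = f.
  Rigid : List Carrier → Set
  Rigid Es = ∀ {e f} r → Allowed Es e → Allowed Es f → e * (r * r) ≈ f → r ≈ 1# ⊎ r ≈ - 1#

  module CliqueBounds {Es ℓ} (Es-≉0 : ∀ {e} → Allowed Es e → ¬ e ≈ 0#) (clique : Clique Es ℓ) where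
    open Clique clique

    private
      Ω : Fin ℓ → Fin ℓ → Carrier
      Ω i j = ω (P i) (S i) (P j) (S j)

    -- With X the left side, the trace -1 + X is that of a transvection up to sign, -1 or 1. The
    -- first would give X = 0, the second gives X = 2 = -1.
    pairing : ∀ i j → ¬ Ω i j ≈ 0# → (E i * E j) * (Ω i j * Ω i j) ≈ - 1#
    pairing i j Ω≉0 with linked i j
    ... | e , p , s , _ , eq with tr-∼ eq
    ...   | inj₂ tr≈ = begin
      X                    ≈⟨ solve 1 (λ X → X := con 𝟙 :+ ((:- con 𝟙) :+ X)) refl X ⟩
      1# + (- 1# + X)      ≈⟨ +-congˡ (tr-adj-T-∙-T (E i) (P i) (S i) (E j) (P j) (S j)) ⟨
      1# + tr (adj (T (E i) (P i) (S i)) ∙ T (E j) (P j) (S j)) ≈⟨ +-congˡ (trans tr≈ (-‿cong (tr-T e p s))) ⟩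
      1# + - - 1#          ≈⟨ solve 0 (con 𝟙 :+ (:- (:- con 𝟙)) := :- con 𝟙) refl ⟩
      - 1#                 ∎
      where
      open SetoidReasoning setoid
      X = (E i * E j) * (Ω i j * Ω i j)
    ...   | inj₁ tr≈ = contradiction (x²≈0⇒x≈0 (xy≈0⇒y≈0 (*-≉0 (Es-≉0 (E-allowed i)) (Es-≉0 (E-allowed j))) (begin
      X                    ≈⟨ solve 1 (λ X → X := con 𝟙 :+ ((:- con 𝟙) :+ X)) refl X ⟩
      1# + (- 1# + X)      ≈⟨ +-congˡ (tr-adj-T-∙-T (E i) (P i) (S i) (E j) (P j) (S j)) ⟨
      1# + tr (adj (T (E i) (P i) (S i)) ∙ T (E j) (P j) (S j)) ≈⟨ +-congˡ (trans tr≈ (tr-T e p s)) ⟩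
      1# - 1#              ≈⟨ -‿inverseʳ 1# ⟩
      0#                   ∎))) Ω≉0
      where
      open SetoidReasoning setoid
      X = (E i * E j) * (Ω i j * Ω i j)

    -- If v_i and v_j are independent, every other v_k is α v_i + β v_j with α , β ∈ {0 , 1 , −1}.
    independent-bound : Rigid Es → ∀ i j → ¬ Ω i j ≈ 0# →
      ℓ ≤ length (cartesianProduct Es (cartesianProduct signs signs))
    independent-bound rigid i j Ω≉0 with inverse (Ω i j) Ω≉0
    ... | w , Ωw≈1 = pigeonhole
      (λ k (e , α , β) → E k ≈ e × P k ≈ α * P i + β * P j × S k ≈ α * S i + β * S j)
      (λ (e≈ , p≈ , s≈) (e≈′ , p≈′ , s≈′) → injective (plus
        (T-cong (trans e≈ (sym e≈′)) (trans p≈ (sym p≈′)) (trans s≈ (sym s≈′)))))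
      (λ k → Any.map
        (λ (e≈ , α≈ , β≈) → e≈ , trans (cramer-P k) (+-cong (*-congʳ α≈) (*-congʳ β≈))
                               , trans (cramer-S k) (+-cong (*-congʳ α≈) (*-congʳ β≈)))
        (Any.cartesianProduct⁺ (E-allowed k) (Any.cartesianProduct⁺
          (coefficient-sign k i j (trans (*-congʳ (*-comm (E j) (E k))) ∘ pairing k j)
            (trans (*-congʳ (*-comm (E j) (E i))) (pairing i j Ω≉0)))
          (coefficient-sign k j i (pairing i k) (pairing i j Ω≉0)))))
      where
      open SetoidReasoning setoid
      cramer-P : ∀ k → P k ≈ (Ω k j * w) * P i + (Ω i k * w) * P j
      cramer-P k = begin
        P k                 ≈⟨ *-identityʳ _ ⟨
        P k * 1#            ≈⟨ *-congˡ Ωw≈1 ⟨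
        P k * (Ω i j * w)   ≈⟨ solve 7 (λ pi si pj sj pk sk w → pk :* ((pi :* sj :- si :* pj) :* w) :=
          ((pk :* sj :- sk :* pj) :* w) :* pi :+ ((pi :* sk :- si :* pk) :* w) :* pj)
          refl (P i) (S i) (P j) (S j) (P k) (S k) w ⟩
        (Ω k j * w) * P i + (Ω i k * w) * P j ∎
      cramer-S : ∀ k → S k ≈ (Ω k j * w) * S i + (Ω i k * w) * S j
      cramer-S k = begin
        S k                 ≈⟨ *-identityʳ _ ⟨
        S k * 1#            ≈⟨ *-congˡ Ωw≈1 ⟨
        S k * (Ω i j * w)   ≈⟨ solve 7 (λ pi si pj sj pk sk w → sk :* ((pi :* sj :- si :* pj) :* w) :=
          ((pk :* sj :- sk :* pj) :* w) :* si :+ ((pi :* sk :- si :* pk) :* w) :* sj)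
          refl (P i) (S i) (P j) (S j) (P k) (S k) w ⟩
        (Ω k j * w) * S i + (Ω i k * w) * S j ∎
      -- Here v_n is the vector paired with both v_k and v_m. Comparing E_n E_k Z² with E_n E_m Ω²,
      -- both -1, gives E_k (Z/Ω)² = E_m, and rigidity yields Z/Ω = ± 1.
      coefficient-sign : ∀ k m n {Z} → (¬ Z ≈ 0# → (E n * E k) * (Z * Z) ≈ - 1#) →
        (E n * E m) * (Ω i j * Ω i j) ≈ - 1# → Any ((Z * w) ≈_) signs
      coefficient-sign k m n {Z} pairing-Z pairing-Ω with Z ≟ 0#
      ... | yes Z≈0 = here (trans (*-congʳ Z≈0) (zeroˡ w))
      ... | no  Z≉0 = there (Sum.[ here , there ∘ here ]′ (rigid (Z * w) (E-allowed k) (E-allowed m)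
        (*-cancelˡ-≉0 (Es-≉0 (E-allowed n)) (begin
          E n * (E k * ((Z * w) * (Z * w)))              ≈⟨ solve 4 (λ g e Z w →
            g :* (e :* ((Z :* w) :* (Z :* w))) := ((g :* e) :* (Z :* Z)) :* (w :* w)) refl (E n) (E k) Z w ⟩
          ((E n * E k) * (Z * Z)) * (w * w)              ≈⟨ *-congʳ (trans (pairing-Z Z≉0) (sym pairing-Ω)) ⟩
          ((E n * E m) * (Ω i j * Ω i j)) * (w * w)      ≈⟨ solve 4 (λ g f Z w →
            ((g :* f) :* (Z :* Z)) :* (w :* w) := (g :* f) :* ((Z :* w) :* (Z :* w))) refl (E n) (E m) (Ω i j) w ⟩
          (E n * E m) * ((Ω i j * w) * (Ω i j * w))      ≈⟨ *-congˡ (trans (*-cong Ωw≈1 Ωw≈1) (*-identityˡ 1#)) ⟩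
          (E n * E m) * 1#                               ≈⟨ *-identityʳ _ ⟩
          E n * E m                                      ∎))))

    CommonAxis : Set
    CommonAxis = ∃ λ p → ∃ λ s → ∃ λ (scale : Fin ℓ → Carrier) → ¬ (p ≈ 0# × s ≈ 0#) ×
      (∀ i → T (E i) (P i) (S i) ≈M T (scale i) p s)

    axis-through : ∀ {p s} → ¬ (p ≈ 0# × s ≈ 0#) → (∀ i → ω p s (P i) (S i) ≈ 0#) → CommonAxis
    axis-through {p} {s} v≉0 ω≈0 = p , s , (λ i → E i * (r i * r i)) , v≉0 , λ i →
      ≈M-trans (T-cong refl (proj₁ (proj₂ (factor i))) (proj₂ (proj₂ (factor i)))) (T-rescale (E i) (r i) p s)
      where
      factor : ∀ i → ∃ λ r → P i ≈ r * p × S i ≈ r * s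
      factor i = parallel v≉0 (ω≈0 i)
      r = proj₁ ∘ factor

    independent-or-axis : (∃ λ i → ∃ λ j → ¬ Ω i j ≈ 0#) ⊎ CommonAxis
    independent-or-axis with Fin.any? (λ i → Fin.any? (λ j → ¬? (Ω i j ≟ 0#)))
    ... | yes independent = inj₁ independent
    ... | no ¬independent with Fin.any? (λ i → ¬? (P i ≟ 0# ×-dec S i ≟ 0#))
    ...   | yes (i , v≉0) = inj₂ (axis-through v≉0
      (λ j → decidable-stable (Ω i j ≟ 0#) (λ Ω≉0 → ¬independent (i , j , Ω≉0))))
    -- All vectors are zero, so any axis serves; (1 , 0) is chosen.
    ...   | no all-zero = inj₂ (axis-through {1#} {0#} (nontrivial ∘ proj₁)
      (λ i → let (p≈0 , s≈0) = decidable-stable (P i ≟ 0# ×-dec S i ≟ 0#) (λ v≉0 → all-zero (i , v≉0)) in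
        trans (+-cong (*-congˡ s≈0) (-‿cong (*-congˡ p≈0))) (solve 0 (con 𝟙 :* con 𝟘 :- con 𝟘 :* con 𝟘 := con 𝟘) refl)))

    module _ (axis : CommonAxis) where
      private
        p s : Carrier
        p = proj₁ axis
        s = proj₁ (proj₂ axis)
        scale : Fin ℓ → Carrier
        scale = proj₁ (proj₂ (proj₂ axis))
        v≉0 : ¬ (p ≈ 0# × s ≈ 0#)
        v≉0 = proj₁ (proj₂ (proj₂ (proj₂ axis)))
        on-axis : ∀ i → T (E i) (P i) (S i) ≈M T (scale i) p s
        on-axis = proj₂ (proj₂ (proj₂ (proj₂ axis)))

      scale-injective : ∀ {i j} → scale i ≈ scale j → i ≡ j
      scale-injective {i} {j} eq = injective (plus (≈M-trans (on-axis i)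
        (≈M-trans (T-cong eq refl refl) (≈M-sym (on-axis j)))))

      axis-bound : ℓ ≤ q
      axis-bound = ≡.subst (ℓ ≤_) length-elements
        (pigeonhole (λ i y → scale i ≈ y) (λ eq eq′ → scale-injective (trans eq (sym eq′))) (∈-elements ∘ scale))

      -- On a common axis the quotient of two members has the difference of their scalars as its
      -- scalar, and linkage puts it in the square class of an allowed scalar unless it vanishes.
      scale-difference : ∀ i j → ∃ λ e → ∃ λ r → Allowed Es e × - scale i + scale j ≈ e * (r * r)
      scale-difference i j with linked i j
      ... | e , p′ , s′ , e∈ , eq with T-∼⇒square {f = e} {p′} {s′} v≉0 (begin
          T (- scale i + scale j) p s                              ≈⟨ plus (T-∙ (- scale i) (scale j) p s) ⟨
          T (- scale i) p s ∙ T (scale j) p s                      ≈⟨ ∙-congʳ (plus (adj-T (scale i) p s)) ⟨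
          adj (T (scale i) p s) ∙ T (scale j) p s                  ≈⟨ ∙-congʳ (adj-cong (plus (on-axis i))) ⟨
          adj (T (E i) (P i) (S i)) ∙ T (scale j) p s              ≈⟨ ∙-congˡ (plus (on-axis j)) ⟨
          adj (T (E i) (P i) (S i)) ∙ T (E j) (P j) (S j)          ≈⟨ eq ⟩
          T e p′ s′                                                ∎)
        where open SetoidReasoning PSL-setoid
      ...   | r , eq′ = e , r , e∈ , eq′

  -- Clique–coclique argument: (i , j) ↦ scale i + t · scale j is injective for a nonsquare t.
  axis-square-bound : ∀ {e₀ ℓ} → (e₀≉0 : ∀ {e} → Allowed (e₀ ∷ []) e → ¬ e ≈ 0#) → (∃ λ t → ¬ IsSquare t) →
    (clique : Clique (e₀ ∷ []) ℓ) → CliqueBounds.CommonAxis e₀≉0 clique → ℓ ℕ.* ℓ ≤ q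
  axis-square-bound {e₀} {ℓ} e₀≉0 (t , t-nonsquare) clique axis = ≡.subst (ℓ ℕ.* ℓ ≤_) length-elements
    (pigeonhole (λ k y → combination (remQuot ℓ k) ≈ y)
      (λ {k} {k′} eq eq′ → ≡.trans (≡.sym (Fin.combine-remQuot {ℓ} ℓ k))
        (≡.trans (≡.cong (uncurry combine) (combination-injective (trans eq (sym eq′)))) (Fin.combine-remQuot {ℓ} ℓ k′)))
      (λ k → ∈-elements _))
    where
    open CliqueBounds e₀≉0 clique
    open SetoidReasoning setoid
    scale = proj₁ (proj₂ (proj₂ axis))
    combination : Fin ℓ × Fin ℓ → Carrier
    combination (i , j) = scale i + t * scale j
    difference : ∀ i j → ∃ λ r → - scale i + scale j ≈ e₀ * (r * r)
    difference i j with scale-difference axis i j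
    ... | e , r , here e≈e₀ , eq = r , trans eq (*-congʳ e≈e₀)
    combination-injective : ∀ {u v} → combination u ≈ combination v → u ≡ v
    combination-injective {i , j} {i′ , j′} eq with difference i′ i | difference j j′
    ... | r , eq-r | z , eq-z = ≡.cong₂ _,_
      (≡.sym (scale-injective axis (zero-difference (trans eq-r (trans (*-congˡ
        (trans r²≈tz² (trans (*-congˡ (trans (*-congʳ z≈0) (zeroˡ z))) (zeroʳ t)))) (zeroʳ e₀))))))
      (scale-injective axis (zero-difference (trans eq-z (trans (*-congˡ (trans (*-congʳ z≈0) (zeroˡ z))) (zeroʳ e₀)))))
      where
      zero-difference : ∀ {x y} → - x + y ≈ 0# → x ≈ y
      zero-difference -x+y≈0 = sym (x-y≈0⇒x≈y (trans (+-comm _ _) -x+y≈0))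
      -- Both differences are e₀ times squares, so e₀ cancels; if z were nonzero, t would be the
      -- square of r/z.
      r²≈tz² : r * r ≈ t * (z * z)
      r²≈tz² = *-cancelˡ-≉0 (e₀≉0 (here refl)) (begin
        e₀ * (r * r)                          ≈⟨ eq-r ⟨
        - scale i′ + scale i                  ≈⟨ solve 4 (λ i i′ t j →
          (:- i′) :+ i := (i :+ t :* j) :- i′ :- t :* j) refl (scale i) (scale i′) t (scale j) ⟩
        combination (i , j) - scale i′ - t * scale j ≈⟨ +-congʳ (+-congʳ eq) ⟩
        combination (i′ , j′) - scale i′ - t * scale j ≈⟨ solve 4 (λ i′ t j j′ →
          (i′ :+ t :* j′) :- i′ :- t :* j := t :* ((:- j) :+ j′)) refl (scale i′) t (scale j) (scale j′) ⟩
        t * (- scale j + scale j′)            ≈⟨ *-congˡ eq-z ⟩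
        t * (e₀ * (z * z))                    ≈⟨ solve 3 (λ t e z → t :* (e :* z) := e :* (t :* z)) refl t e₀ (z * z) ⟩
        e₀ * (t * (z * z))                    ∎)
      z≈0 : z ≈ 0#
      z≈0 = decidable-stable (z ≟ 0#) (λ z≉0 → t-nonsquare
        (let (x , t≈) = square-ratio {t} {1#} {z} {r} z≉0 (trans (sym r²≈tz²) (sym (*-identityˡ _)))
         in x , sym (trans t≈ (*-identityˡ _))))

-- From cliques to the intersection density

module Density {q : ℕ} (F : FiniteField q)
  (1+1+1≈0 : HasCharacteristic3 F) where
  open Cliques F 1+1+1≈0 public
  open Solver

  opaque
    unfolding _∙_ adj ∼⇒~

    fromDefs-subgroup : ∀ {H} → IsSubgroupPSL F H → IsSubgroup H
    fromDefs-subgroup (sl , resp , one , mul , inv) = record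
      { H-SL = sl _ ; H-resp = λ eq → resp _ _ (∼⇒~ eq) ; H-I = one ; H-∙ = mul _ _ ; H-adj = inv _ }

    fromDefs-agree : ∀ {H g h} → (∃ λ x → SL x × _≡H_ F H (Defs._·_ F g x) (Defs._·_ F h x)) →
      ∃ λ x → SL x × ∃ λ k → H k × h ∙ x ∼ (g ∙ x) ∙ k
    fromDefs-agree (x , sx , k , hk , eq) = x , sx , k , hk , ~⇒∼ eq

    toDefs-agree : ∀ {H g h} → (∃ λ x → SL x × ∃ λ k → H k × h ∙ x ∼ (g ∙ x) ∙ k) →
      ∃ λ x → SL x × _≡H_ F H (Defs._·_ F g x) (Defs._·_ F h x)
    toDefs-agree (x , sx , k , hk , eq) = x , sx , k , hk , ∼⇒~ eq

    fromDefs-stab : ∀ {H x g} → Stab F H x g → SL g × ∃ λ k → H k × x ∼ (g ∙ x) ∙ k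
    fromDefs-stab (sg , k , hk , eq) = sg , k , hk , ~⇒∼ eq

    toDefs-stab : ∀ {H x g} → (SL g × ∃ λ k → H k × x ∼ (g ∙ x) ∙ k) → Stab F H x g
    toDefs-stab (sg , k , hk , eq) = sg , k , hk , ∼⇒~ eq

  fromDefs-card : ∀ {P Q : Mat F → Set} {k} → (∀ {m} → P m → Q m) → (∀ {m} → Q m → P m) →
    IsCard (Defs._~_ F) P k → IsCard _∼_ Q k
  fromDefs-card P⇒Q Q⇒P (xs , len , all , distinct , cover) = xs , len , All.map P⇒Q all ,
    AllPairs.map (λ x≁y x∼y → x≁y (∼⇒~ x∼y)) distinct , λ m qm → Any.map ~⇒∼ (cover m (Q⇒P qm))

  toDefs-card : ∀ {P Q : Mat F → Set} {k} → (∀ {m} → P m → Q m) → (∀ {m} → Q m → P m) →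
    IsCard _∼_ P k → IsCard (Defs._~_ F) Q k
  toDefs-card P⇒Q Q⇒P (xs , len , all , distinct , cover) = xs , len , All.map P⇒Q all ,
    AllPairs.map (λ x≁y x∼y → x≁y (~⇒∼ x∼y)) distinct , λ m qm → Any.map ∼⇒~ (cover m (Q⇒P qm))

  module _ {H : Mat F → Set} (subgroup : IsSubgroup H) (card-H : IsCard _∼_ H 3)
    {e₀ p₀ s₀ : Carrier} (e₀≉0 : ¬ e₀ ≈ 0#) (v₀≉0 : ¬ (p₀ ≈ 0# × s₀ ≈ 0#)) (h₊ : H (T e₀ p₀ s₀)) (h₋ : H (T (- e₀) p₀ s₀))
    (cover : ∀ k → H k → k ∼ I ⊎ k ∼ T e₀ p₀ s₀ ⊎ k ∼ T (- e₀) p₀ s₀) where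

    open TransvectionSubgroup subgroup card-H e₀ p₀ s₀ v₀≉0 h₊ h₋ cover

    LinkedIn : List Carrier → Mat F → Mat F → Set
    LinkedIn Es g h = ∃ λ e → ∃ λ p → ∃ λ s → Allowed Es e × adj g ∙ h ∼ T e p s

    -- Left division by `g₀` preserves quotients: (g₀⁻¹ g_i)⁻¹ (g₀⁻¹ g_j) = g_i⁻¹ g_j. The
    -- coordinates of g_i come from its own link to `g₀`, with the scalar brought into `Es` by
    -- `normalise`.
    intersecting⇒clique : ∀ {Es} → (∀ {g h} → Linked g h → LinkedIn Es g h) → ∀ {g₀ L} →
      IsGroupSubset F H (g₀ ∷ L) → Intersecting F H (g₀ ∷ L) → Clique Es (length (g₀ ∷ L))
    intersecting⇒clique {Es} normalise {g₀} {L} (sl , distinct) intersecting = record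
      { E = λ i → proj₁ (base i) ; P = λ i → proj₁ (proj₂ (base i)) ; S = λ i → proj₁ (proj₂ (proj₂ (base i)))
      ; E-allowed = λ i → proj₁ (proj₂ (proj₂ (proj₂ (base i))))
      ; injective = λ {i} {j} eq → distinct⇒index-injective ∼-sym (AllPairs.map (λ x≁y x∼y → x≁y (∼⇒~ x∼y)) distinct)
          (∙-cancelˡ (SL-adj (SL-at zero)) (∼-trans (to-T i) (∼-trans eq (∼-sym (to-T j)))))
      ; linked = λ i j → let (e , p , s , e∈ , eq) = link i j in e , p , s , e∈ , (begin
          adj (T _ _ _) ∙ T _ _ _                      ≈⟨ ∼-trans (∙-congʳ (adj-cong (∼-sym (to-T i)))) (∙-congˡ (∼-sym (to-T j))) ⟩
          adj (adj g₀ ∙ at i) ∙ (adj g₀ ∙ at j)        ≈⟨ ∙-congʳ (plus (adj-∙ (adj g₀) (at i))) ⟩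
          (adj (at i) ∙ adj (adj g₀)) ∙ (adj g₀ ∙ at j) ≈⟨ plus (∙-assoc _ _ _) ⟩
          adj (at i) ∙ (adj (adj g₀) ∙ (adj g₀ ∙ at j)) ≈⟨ ∙-congˡ (plus (adj-cancelˡ (at j) (SL-adj (SL-at zero)))) ⟩
          adj (at i) ∙ at j                            ≈⟨ eq ⟩
          T e p s                                      ∎)
      }
      where
      open SetoidReasoning PSL-setoid
      at : Fin (length (g₀ ∷ L)) → Mat F
      at = lookup (g₀ ∷ L)
      SL-at : ∀ i → SL (at i)
      SL-at i = All.lookup sl (∈-lookup i)
      link : ∀ i j → LinkedIn Es (at i) (at j)
      link i j = normalise (agree⇒linked (SL-at i) (fromDefs-agree (intersecting (at i) (at j) (∈-lookup i) (∈-lookup j))))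
      base : ∀ i → LinkedIn Es g₀ (at i)
      base = link zero
      to-T : ∀ i → adj g₀ ∙ at i ∼ T (proj₁ (base i)) (proj₁ (proj₂ (base i))) (proj₁ (proj₂ (proj₂ (base i))))
      to-T i = proj₂ (proj₂ (proj₂ (proj₂ (base i))))

    -- The parities differ only in `cs`, `Es` and the clique bound. The extremal set may lie in the
    -- root subgroup of (1 , 0) instead of that of v₀, because all nonzero vectors are conjugate.
    density : ∀ {Es} → (∀ {g h} → Linked g h → LinkedIn Es g h) → ∀ r cs → length cs ≡ r ℕ.* 3 → Distinct cs →
      (∀ {x y} → x ∈ cs → y ∈ cs → ∃ λ e → ∃ λ z → Admissible e × - x + y ≈ e * (z * z)) →
      (∀ {ℓ} → Clique Es ℓ → ℓ ≤ r ℕ.* 3) → DensityEq F H r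
    density normalise r cs len distinct square-differences bound =
      3 ,
      ((I , SL-I , toDefs-card toDefs-stab fromDefs-stab (stabilizer-card SL-I)) ,
       λ x k sx card → stabilizer-card-max sx (fromDefs-card fromDefs-stab toDefs-stab card)) ,
      (map u cs ,
       (All.map⁺ (All.tabulate (λ _ → T-SL _ 1# 0#)) ,
        AllPairs.map⁺ (AllPairs.map (λ x≉y eq → x≉y (T-∼⇒scale≈ (~⇒∼ eq))) distinct)) ,
       u-intersecting , ≡.trans (List.length-map u cs) len) ,
      λ { [] _ _ → z≤n
        ; (g₀ ∷ L) subset intersecting → bound (intersecting⇒clique normalise subset intersecting) }
      where
      u : Carrier → Mat F
      u x = T x 1# 0#
      u-linked : ∀ {x y} → x ∈ cs → y ∈ cs → Linked (u x) (u y)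
      u-linked {x} {y} x∈ y∈ with square-differences x∈ y∈
      -- A square factor z² of the scalar is moved into the vector as a factor z.
      ... | e , z , adm , eq = e , z * 1# , z * 0# , adm , (begin
        adj (T x 1# 0#) ∙ T y 1# 0#      ≈⟨ ∙-congʳ (plus (adj-T x 1# 0#)) ⟩
        T (- x) 1# 0# ∙ T y 1# 0#        ≈⟨ plus (T-∙ (- x) y 1# 0#) ⟩
        T (- x + y) 1# 0#                ≈⟨ plus (T-cong eq refl refl) ⟩
        T (e * (z * z)) 1# 0#            ≈⟨ plus (T-rescale e z 1# 0#) ⟨
        T e (z * 1#) (z * 0#)            ∎)
        where open SetoidReasoning PSL-setoid
      u-intersecting : Intersecting F H (map u cs)
      u-intersecting g h g∈ h∈ with ∈-map⁻ u g∈ | ∈-map⁻ u h∈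
      ... | x , x∈ , ≡.refl | y , y∈ , ≡.refl = toDefs-agree (linked⇒agree (T-SL x 1# 0#) (u-linked x∈ y∈))

    divide : ∀ {x y} → ¬ x ≈ 0# → ∃ λ z → y ≈ x * z
    divide {x} {y} x≉0 = let (i , xi≈1) = inverse x x≉0 in i * y , sym (trans (sym (*-assoc x i y))
      (trans (*-congʳ xi≈1) (*-identityˡ y)))

    density-odd : ∀ j r → q ≡ 3 ℕ.+ 4 ℕ.* j → q ≡ r ℕ.* 3 → 18 ≤ q → DensityEq F H r
    density-odd j r q≡ q≡r*3 18≤q = density {Es} normalise r elements (≡.trans length-elements q≡r*3) elements-distinct
      (λ {x} {y} _ _ → square-difference (- x + y)) (λ {ℓ} clique → ≡.subst (ℓ ≤_) q≡r*3 (bound clique))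
      where
      open q≡3mod4 j q≡
      Es = e₀ ∷ - e₀ ∷ []
      normalise : ∀ {g h} → Linked g h → LinkedIn Es g h
      normalise (e , p , s , inj₁ e≈ , eq) = e , p , s , here e≈ , eq
      normalise (e , p , s , inj₂ e≈ , eq) = e , p , s , there (here e≈) , eq
      -e₀≉0 : ¬ - e₀ ≈ 0#
      -e₀≉0 -e₀≈0 = e₀≉0 (trans (sym (-‿involutive e₀)) (trans (-‿cong -e₀≈0) -0#≈0#))
      Es≉0 : ∀ {e} → Allowed Es e → ¬ e ≈ 0#
      Es≉0 (here e≈)         e≈0 = e₀≉0 (trans (sym e≈) e≈0)
      Es≉0 (there (here e≈)) e≈0 = -e₀≉0 (trans (sym e≈) e≈0)
      same : ∀ {e f r} → e ≈ f → ¬ f ≈ 0# → e * (r * r) ≈ f → r ≈ 1# ⊎ r ≈ - 1#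
      same e≈f f≉0 eq = x²≈1⇒x≈±1 (*-cancelˡ-≉0 f≉0 (trans (*-congʳ (sym e≈f)) (trans eq (sym (*-identityʳ _)))))
      -- -f r² = f would make r a square root of -1; this excludes the mixed cases of `rigid`.
      opposite : ∀ {e f r} → e ≈ - f → ¬ f ≈ 0# → ¬ e * (r * r) ≈ f
      opposite {e} {f} {r} e≈-f f≉0 eq = -1-nonsquare (r , *-cancelˡ-≉0 f≉0 (trans
        (solve 2 (λ f x → f :* x := :- ((:- f) :* x)) refl f (r * r))
        (trans (-‿cong (trans (*-congʳ (sym e≈-f)) eq)) (solve 1 (λ f → :- f := f :* (:- con 𝟙)) refl f))))
      rigid : Rigid Es
      rigid r (here e≈) (here f≈) eq = same (trans e≈ (sym f≈)) (Es≉0 (here f≈)) eq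
      rigid r (there (here e≈)) (there (here f≈)) eq = same (trans e≈ (sym f≈)) (Es≉0 (there (here f≈))) eq
      rigid r (here e≈) (there (here f≈)) eq = contradiction eq
        (opposite (trans e≈ (trans (sym (-‿involutive e₀)) (-‿cong (sym f≈)))) (Es≉0 (there (here f≈))))
      rigid r (there (here e≈)) (here f≈) eq = contradiction eq
        (opposite (trans e≈ (-‿cong (sym f≈))) (Es≉0 (here f≈)))
      bound : ∀ {ℓ} → Clique Es ℓ → ℓ ≤ q
      bound clique = Sum.[ (λ (i , k , Ω≉0) → ℕ.≤-trans (independent-bound rigid i k Ω≉0) 18≤q) , axis-bound ]′ independent-or-axis
        where open CliqueBounds Es≉0 clique
      square-difference : ∀ x → ∃ λ e → ∃ λ z → Admissible e × x ≈ e * (z * z)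
      square-difference x with divide {e₀} {x} e₀≉0
      ... | c , x≈e₀c with ±square c
      ...   | inj₁ (z , z²≈c)  = e₀ , z , inj₁ refl , trans x≈e₀c (*-congˡ (sym z²≈c))
      ...   | inj₂ (z , z²≈-c) = - e₀ , z , inj₂ refl , trans x≈e₀c (trans
        (solve 2 (λ e c → e :* c := (:- e) :* (:- c)) refl e₀ c) (*-congˡ (sym z²≈-c)))

    density-even : ∀ m j r → 3 ℕ.^ m ≡ suc (suc j ℕ.* 2) → q ≡ 3 ℕ.^ m ℕ.* 3 ℕ.^ m → 3 ℕ.^ m ≡ r ℕ.* 3 → 9 ≤ 3 ℕ.^ m →
      DensityEq F H r
    -- The subfield is multiplied by e₀ because differences must be e₀ times squares, while e₀
    -- itself may be a nonsquare.
    density-even m j r 3^m≡ q≡ 3^m≡r*3 9≤3^m = density {Es} normalise r (map (e₀ *_) subfield)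
      (≡.trans (List.length-map (e₀ *_) subfield) (≡.trans length-subfield 3^m≡r*3))
      (AllPairs.map⁺ (AllPairs.map (λ x≉y eq → x≉y (*-cancelˡ-≉0 e₀≉0 eq)) subfield-distinct))
      square-difference
      (λ {ℓ} clique → ≡.subst (ℓ ≤_) 3^m≡r*3 (bound clique))
      where
      open q≡r² m j 3^m≡ q≡
      Es = e₀ ∷ []
      i = proj₁ -1-square
      normalise : ∀ {g h} → Linked g h → LinkedIn Es g h
      normalise (e , p , s , inj₁ e≈ , eq) = e , p , s , here e≈ , eq
      -- With i² = -1, the scalar -e₀ = e₀ i² on v becomes e₀ on i v.
      normalise (e , p , s , inj₂ e≈ , eq) = e₀ , i * p , i * s , here refl , ∼-trans eq (plus (≈M-trans
        (T-cong (trans e≈ (trans (solve 1 (λ e → :- e := e :* (:- con 𝟙)) refl e₀) (*-congˡ (sym (proj₂ -1-square))))) refl refl)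
        (≈M-sym (T-rescale e₀ i p s))))
      Es≉0 : ∀ {e} → Allowed Es e → ¬ e ≈ 0#
      Es≉0 (here e≈) e≈0 = e₀≉0 (trans (sym e≈) e≈0)
      rigid : Rigid Es
      rigid r (here e≈) (here f≈) eq = x²≈1⇒x≈±1 (*-cancelˡ-≉0 e₀≉0
        (trans (*-congʳ (sym e≈)) (trans eq (trans f≈ (sym (*-identityʳ _))))))
      bound : ∀ {ℓ} → Clique Es ℓ → ℓ ≤ 3 ℕ.^ m
      bound {ℓ} clique = Sum.[ (λ (i , k , Ω≉0) → ℕ.≤-trans (independent-bound rigid i k Ω≉0) 9≤3^m)
        , (λ axis → ℕ.≮⇒≥ (λ 3^m<ℓ → ℕ.<⇒≱ (ℕ.*-mono-< 3^m<ℓ 3^m<ℓ)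
            (≡.subst (ℓ ℕ.* ℓ ≤_) q≡ (axis-square-bound Es≉0 nonsquare clique axis)))) ]′ independent-or-axis
        where open CliqueBounds Es≉0 clique
      square-difference : ∀ {x y} → x ∈ map (e₀ *_) subfield → y ∈ map (e₀ *_) subfield →
        ∃ λ e → ∃ λ z → Admissible e × - x + y ≈ e * (z * z)
      square-difference x∈ y∈ with ∈-map⁻ (e₀ *_) x∈ | ∈-map⁻ (e₀ *_) y∈
      ... | a , a∈ , ≡.refl | b , b∈ , ≡.refl with subfield-difference-square b∈ a∈
      ...   | z , z²≈b-a = e₀ , z , inj₁ refl , trans
        (solve 3 (λ e a b → :- (e :* a) :+ e :* b := e :* (b :- a)) refl e₀ a b) (*-congˡ (sym z²≈b-a))

-- Powers of 3 and the two parities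

odd-power-mod-4 : ∀ m → ∃ λ j → 3 ^ suc (m ℕ.* 2) ≡ 3 ℕ.+ 4 ℕ.* j
odd-power-mod-4 zero    = 0 , ≡.refl
odd-power-mod-4 (suc m) with odd-power-mod-4 m
... | j , eq = 6 ℕ.+ 9 ℕ.* j , ≡.trans (≡.cong (λ x → 3 ℕ.* (3 ℕ.* x)) eq)
  (solve 1 (λ j → con 3 :* (con 3 :* (con 3 :+ con 4 :* j)) := con 3 :+ con 4 :* (con 6 :+ con 9 :* j)) ≡.refl j)
  where open +-*-Solver

-- The form 1 + 2 (j + 1) records both that the power is odd and that it is at least 3.
power-odd : ∀ m → ∃ λ j → 3 ^ suc m ≡ suc (suc j ℕ.* 2)
power-odd zero    = 0 , ≡.refl
power-odd (suc m) with power-odd m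
... | j , eq = 3 ℕ.+ 3 ℕ.* j , ≡.trans (≡.cong (3 ℕ.*_) eq)
  (solve 1 (λ j → con 3 :* (con 3 :+ j :* con 2) := con 3 :+ (con 3 :+ con 3 :* j) :* con 2) ≡.refl j)
  where open +-*-Solver

^-pred : ∀ n → 1 ≤ n → 3 ^ n ≡ 3 ^ (n ∸ 1) ℕ.* 3
^-pred (suc n) _ = ℕ.*-comm 3 (3 ^ n)

open Defs using (_~_)

theorem7p1 : (n : ℕ) → 3 ≤ n → (F : FiniteField (3 ^ n)) → (H : Mat F → Set)
    → IsSubgroupPSL F H → IsCard (_~_ F) H 3
    → (n % 2 ≡ 1 → DensityEq F H (3 ^ (n ∸ 1)))
    × (n % 2 ≡ 0 → DensityEq F H (3 ^ (n / 2 ∸ 1)))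
theorem7p1 n 3≤n F H isSubgroup isCard = odd , even
  where
  open Density F (FieldTheory.char-3 F n ≡.refl)
  subgroup = fromDefs-subgroup isSubgroup
  card-H = fromDefs-card id id isCard
  odd : n % 2 ≡ 1 → DensityEq F H (3 ^ (n ∸ 1))
  odd n%2≡1 =
    let (e , p , s , e≉0 , v≉0 , h₊ , h₋ , cover) = order-3⇒transvections subgroup card-H
        (j , eq) = odd-power-mod-4 (n / 2)
        n≡ = ≡.trans (m≡m%n+[m/n]*n n 2) (≡.cong (ℕ._+ n / 2 ℕ.* 2) n%2≡1)
    in density-odd subgroup card-H e≉0 v≉0 h₊ h₋ cover j (3 ^ (n ∸ 1))
         (≡.trans (≡.cong (3 ^_) n≡) eq)
         (^-pred n (ℕ.≤-trans (s≤s z≤n) 3≤n))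
         -- 18 ≤ 18 + 9 = 3³ ≤ 3^n.
         (ℕ.≤-trans (ℕ.m≤m+n 18 9) (ℕ.^-monoʳ-≤ 3 3≤n))
  even : n % 2 ≡ 0 → DensityEq F H (3 ^ (n / 2 ∸ 1))
  even n%2≡0 =
    let (e , p , s , e≉0 , v≉0 , h₊ , h₋ , cover) = order-3⇒transvections subgroup card-H
        m = n / 2
        n≡m*2 = ≡.trans (m≡m%n+[m/n]*n n 2) (≡.cong (ℕ._+ m ℕ.* 2) n%2≡0)
        -- 1 · 2 < n = m · 2 gives m ≥ 2, which supplies 9 ≤ 3^m.
        2≤m = ℕ.*-cancelʳ-< 2 1 m (≡.subst (3 ≤_) n≡m*2 3≤n)
        1≤m = ℕ.≤-trans (s≤s z≤n) 2≤m
        (j , eq) = power-odd (m ∸ 1)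
    in density-even subgroup card-H e≉0 v≉0 h₊ h₋ cover m j (3 ^ (m ∸ 1))
         (≡.trans (≡.cong (3 ^_) (≡.sym (ℕ.m+[n∸m]≡n 1≤m))) eq)
         (≡.trans (≡.cong (3 ^_) (≡.trans n≡m*2 (≡.trans (ℕ.*-comm m 2) (≡.cong (m ℕ.+_) (ℕ.+-identityʳ m)))))
           (ℕ.^-distribˡ-+-* 3 m m))
         (^-pred m 1≤m)
         (ℕ.^-monoʳ-≤ 3 2≤m)
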